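{- For a finite bipartite graph $G$ (with bipartition $(X,Y)$) the following are equivalent: (i) $G$ is a cocomparability bigraph; (ii) $\overline{G}$ has an acyclic $T$-free orientation; (iii) $\overline{G}$ has a $T$-free orientation; (iv) $G$ does not contain an invertible pair; (v) $G$ does not contain a weak edge-asteroid; (vi) $G$ does not contain an edge-asteroid; (vii) $I(G)$ is a comparability graph.
   Context: $G$ is a cocomparability bigraph if there exist linear orderings $\prec_X$ of $X$ and $\prec_Y$ of $Y$ such that for all $u,v\in X$, $w,z\in Y$ with $u\prec_X v$, $w\prec_Y z$ and $uz,vw\in E(G)$, at least one of $uw,vz$ is in $E(G)$. Two edges $xy,x'y'$ ($x,x'\in X$, $y,y'\in Y$) are independent if they are disjoint and $xy'\notin E(G)$, $x'y\notin E(G)$. $I(G)$ has vertex set $E(G)$, two edges adjacent iff independent; a comparability graph is one admitting a transitive orientation. An orientation of the complement $\overline{G}$ is a mixed graph in which every non-edge $xy$ of $G$ with $x\in X,y\in Y$ is an undirected edge and every pair of distinct vertices both in $X$ or both in $Y$ is oriented in exactly one direction; it is acyclic if it has no directed cycle, and $T$-free if there are no $x,x'\in X$, $y,y'\in Y$ with $xy,x'y'\notin E(G)$, $xy',x'y\in E(G)$, and arcs $x\to x'$, $y\to y'$. Two walks $a_1\dots a_k$, $b_1\dots b_k$ with $a_1,b_1$ in the same part are congruent if for each $i$ the edges $a_ia_{i+1}$, $b_ib_{i+1}$ are independent; $u,v$ is an invertible pair if there are congruent walks from $u$ to $v$ and from $v$ to $u$. An edge-asteroid is a set of $2k+1$ ($k\ge1$)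 distinct edges $e_0,\dots,e_{2k}$ such that for each $i$ there is a walk containing both end vertices of $e_{i+k}$ and both end vertices of $e_{i+k+1}$ and no vertex adjacent to an end vertex of $e_i$ (indices mod $2k+1$); a weak edge-asteroid is the same without requiring the edges to be distinct. -}

module Defs where

open import Data.Nat using (ℕ; zero; suc; _+_; _<_; _≤_; _%_)
open import Data.Nat.DivMod using (m%n<n)
open import Data.Fin using (Fin; zero; suc; toℕ; fromℕ; fromℕ<; inject₁)
open import Data.Bool using (Bool; true; false; T)
open import Data.Sum using (_⊎_; inj₁; inj₂)
open import Data.Product using (Σ; ∃; ∃-syntax; _×_; _,_)
open import Data.Empty using (⊥)
open import Relation.Nullary using (¬_)
open import Relation.Binary.PropositionalEquality using (_≡_; _≢_)
open import Relation.Binary.Structures using (IsStrictTotalOrder)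
open import Relation.Binary.Construct.Closure.Transitive using (TransClosure)

-- A finite bipartite graph with parts X = Fin m and Y = Fin n is given by
-- its biadjacency matrix  G : Fin m → Fin n → Bool  (x ~ y iff T (G x y)).
BiGraph : ℕ → ℕ → Set
BiGraph m n = Fin m → Fin n → Bool

IsComparabilityGraph : {V : Set} → (V → V → Set) → Set₁
IsComparabilityGraph {V} Adj =
  Σ (V → V → Set) λ O →
    (∀ a b → O a b → Adj a b) ×
    (∀ a b → Adj a b → O a b ⊎ O b a) ×
    (∀ a b → O a b → ¬ O b a) ×
    (∀ a b c → O a b → O b c → O a c)

module _ {m n : ℕ} (G : BiGraph m n) where

  E : Fin m → Fin n → Set
  E x y = T (G x y)

  V : Set
  V = Fin m ⊎ Fin n

  Adj : V → V → Set
  Adj (inj₁ x) (inj₂ y) = E x y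
  Adj (inj₂ y) (inj₁ x) = E x y
  Adj (inj₁ _) (inj₁ _) = ⊥
  Adj (inj₂ _) (inj₂ _) = ⊥

  inX : V → Bool
  inX (inj₁ _) = true
  inX (inj₂ _) = false

  SamePart : V → V → Set
  SamePart a b = inX a ≡ inX b

  CocomparabilityBigraph : Set₁
  CocomparabilityBigraph =
    Σ (Fin m → Fin m → Set) λ _≺X_ →
    Σ (Fin n → Fin n → Set) λ _≺Y_ →
      IsStrictTotalOrder _≡_ _≺X_ × IsStrictTotalOrder _≡_ _≺Y_ ×
      (∀ u v w z → u ≺X v → w ≺Y z → E u z → E v w → E u w ⊎ E v z)

  -- (ii),(iii) orientations of the complement.  The undirected edges (the
  -- non-edges xy of G, x ∈ X, y ∈ Y) are fixed; the data are the arcs inside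
  -- X and inside Y: every pair of distinct vertices in the same part is
  -- oriented in exactly one direction (and there are no loops).
  IsTournament : {A : Set} → (A → A → Set) → Set
  IsTournament {A} R =
    (∀ a → ¬ R a a) ×
    (∀ a b → a ≢ b → (R a b × ¬ R b a) ⊎ (R b a × ¬ R a b))

  record Orientation : Set₁ where
    field
      arcX : Fin m → Fin m → Set
      arcY : Fin n → Fin n → Set
      tourX : IsTournament arcX
      tourY : IsTournament arcY
  open Orientation public

  -- no directed cycle (directed cycles consist of arcs only)
  Acyclic : Orientation → Set
  Acyclic o = (∀ x → ¬ TransClosure (arcX o) x x) × (∀ y → ¬ TransClosure (arcY o) y y)

  TFree : Orientation → Set
  TFree o = ¬ (Σ (Fin m) λ x → Σ (Fin m) λ x' → Σ (Fin n) λ y → Σ (Fin n) λ y' →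
      ¬ E x y × ¬ E x' y' × E x y' × E x' y × arcX o x x' × arcY o y y')

  Indep : Fin m → Fin n → Fin m → Fin n → Set
  Indep x y x' y' = E x y × E x' y' × x ≢ x' × y ≢ y' × ¬ E x y' × ¬ E x' y

  EdgeXY : V → V → Fin m → Fin n → Set
  EdgeXY a a' x y = (a ≡ inj₁ x × a' ≡ inj₂ y) ⊎ (a ≡ inj₂ y × a' ≡ inj₁ x)

  IndepV : V → V → V → V → Set
  IndepV a a' b b' = Σ (Fin m) λ x → Σ (Fin n) λ y → Σ (Fin m) λ x' → Σ (Fin n) λ y' →
    EdgeXY a a' x y × EdgeXY b b' x' y' × Indep x y x' y'

  IsWalk : (k : ℕ) → (Fin (suc k) → V) → Set
  IsWalk k w = ∀ (i : Fin k) → Adj (w (inject₁ i)) (w (suc i))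

  Congruent : (k : ℕ) → (Fin (suc k) → V) → (Fin (suc k) → V) → Set
  Congruent k a b = SamePart (a zero) (b zero) ×
    (∀ (i : Fin k) → IndepV (a (inject₁ i)) (a (suc i)) (b (inject₁ i)) (b (suc i)))

  InvertiblePair : V → V → Set
  InvertiblePair u v = u ≢ v × Σ ℕ λ k → Σ (Fin (suc k) → V) λ a → Σ (Fin (suc k) → V) λ b →
    IsWalk k a × IsWalk k b ×
    a zero ≡ u × a (fromℕ k) ≡ v × b zero ≡ v × b (fromℕ k) ≡ u ×
    Congruent k a b

  HasInvertiblePair : Set
  HasInvertiblePair = Σ V λ u → Σ V λ v → InvertiblePair u v

  _⊕_ : {N : ℕ} → Fin (suc N) → ℕ → Fin (suc N)
  _⊕_ {N} i j = fromℕ< (m%n<n (toℕ i + j) (suc N))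

  Occurs : {l : ℕ} → (Fin (suc l) → V) → V → Set
  Occurs {l} w v = Σ (Fin (suc l)) λ j → w j ≡ v

  WeakEdgeAsteroidOn : (k : ℕ) → (Fin (suc (k + k)) → Fin m) → (Fin (suc (k + k)) → Fin n) → Set
  WeakEdgeAsteroidOn k ex ey =
    (∀ i → E (ex i) (ey i)) ×
    (∀ i → Σ ℕ λ l → Σ (Fin (suc l) → V) λ w →
       IsWalk l w ×
       Occurs w (inj₁ (ex (i ⊕ k))) × Occurs w (inj₂ (ey (i ⊕ k))) ×
       Occurs w (inj₁ (ex (i ⊕ suc k))) × Occurs w (inj₂ (ey (i ⊕ suc k))) ×
       (∀ j → ¬ Adj (w j) (inj₁ (ex i)) × ¬ Adj (w j) (inj₂ (ey i))))

  HasWeakEdgeAsteroid : Set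
  HasWeakEdgeAsteroid = Σ ℕ λ k → 1 ≤ k × Σ (Fin (suc (k + k)) → Fin m) λ ex →
    Σ (Fin (suc (k + k)) → Fin n) λ ey → WeakEdgeAsteroidOn k ex ey

  HasEdgeAsteroid : Set
  HasEdgeAsteroid = Σ ℕ λ k → 1 ≤ k × Σ (Fin (suc (k + k)) → Fin m) λ ex →
    Σ (Fin (suc (k + k)) → Fin n) λ ey →
      (∀ i j → ex i ≡ ex j → ey i ≡ ey j → i ≡ j) × WeakEdgeAsteroidOn k ex ey

  EdgeOf : Set
  EdgeOf = Σ (Fin m × Fin n) λ { (x , y) → E x y }

  IndepEdges : EdgeOf → EdgeOf → Set
  IndepEdges ((x , y) , _) ((x' , y') , _) = Indep x y x' y'

  IGComparability : Set₁
  IGComparability = IsComparabilityGraph IndepEdges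

{-# OPTIONS --safe #-}
module Submission where

-- Fix independent edges xy and x′y′: in a T-free orientation x → x′ iff y → y′. Along congruent
-- walks the arcs are thus forced, and a T-free orientation chooses one of each pair of reverse
-- classes of arcs; this is possible iff no class is its own reverse, i.e. there is no invertible
-- pair. Choosing the class containing the lexicographically first pair of vertices of X avoids
-- cyclic triangles: a cyclic triangle a, b, c of forced arcs sits opposite an induced matching of
-- G or of its bipartite complement, which can be slid along congruent walks from b, c while a
-- stays put, so the class of the arc bc never reaches a. Arcs that are not forced join vertices
-- with nested neighbourhoods and are oriented by inclusion.
--
-- Ordering independent edges by their ends in X makes I(G) a comparability graph, and a
-- transitive orientation, carried around a weak edge-asteroid, would be reversed. Conversely an
-- invertible pair gives a closed walk of odd length in Gallai's knotting graph of I(G); a shortest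
-- one visits no edge of G twice, and so is an edge-asteroid.

open import Defs
open import Data.Bool using (Bool; true; false; T; not)
open import Data.Bool.Properties using (T-≡; T?; T-irrelevant; not-injective) renaming (_≟_ to _≟ᵇ_)
open import Data.Empty using (⊥; ⊥-elim)
open import Data.Fin as Fin using (Fin; zero; suc; toℕ; fromℕ; fromℕ<; inject₁; combine; remQuot; _≟_)
open import Data.Fin.Induction using (<-wellFounded)
import Data.Fin.Properties as Fin
open import Data.Fin.Properties
  using (any?; combine-monoˡ-<; combine-injective; remQuot-combine; combine-remQuot;
         toℕ-injective; toℕ-fromℕ<; toℕ<n; fromℕ<-cong)
open import Data.List using (List; []; _∷_; allFin; cartesianProduct)
open import Data.List.Membership.Propositional using (_∈_)
open import Data.List.Membership.Propositional.Properties using (∈-allFin; ∈-cartesianProduct⁺)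
open import Data.List.Relation.Unary.Any using (here; there)
open import Data.Nat using (ℕ; zero; suc; _+_; _*_; _∸_; _%_; _≤_; _<_; z≤n; s≤s)
open import Data.Nat.DivMod
  using (m%n<n; m%n%n≡m%n; m<n⇒m%n≡m; n%n≡0; [m+n]%n≡m%n; [m+kn]%n≡m%n; %-distribˡ-+; %-distribˡ-*)
open import Data.Nat.Induction using (<-rec)
open import Data.Nat.Properties
  using (≤-refl; ≤-trans; ≤-antisym; <⇒≤; <⇒≱; <-cmp; n<1+n; m≤m+n; m≤n+m; m<m+n; m≤n⇒m<n∨m≡n;
         +-suc; +-comm; +-assoc; +-identityʳ; +-monoˡ-<; +-monoʳ-≤; +-mono-≤-<;
         m+[n∸m]≡n; m∸n+n≡m; m<n⇒0<n∸m; ∸-monoˡ-≤; ∸-monoˡ-<)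
open import Data.Nat.Solver using (module +-*-Solver)
open import Data.Product using (Σ; ∃; ∃₂; _×_; _,_; proj₁; proj₂)
open import Data.Product.Properties using (≡-dec)
open import Data.Sum using (_⊎_; inj₁; inj₂; [_,_]′) renaming (swap to ⊎-swap)
open import Data.Vec.Functional using () renaming (_∷_ to _◂_)
open import Function using (flip; id; _∘_)
open import Function.Bundles using (_⇔_; mk⇔; Equivalence)
open import Induction.WellFounded using (Acc; acc)
open import Relation.Binary.Construct.Closure.ReflexiveTransitive as Star using (Star; ε; _◅_; _◅◅_)
open import Relation.Binary.Construct.Closure.Transitive using (TransClosure; [_]; _∷_)
open import Relation.Binary.Definitions using (Decidable; Trichotomous; tri<; tri≈; tri>)
open import Relation.Binary.PropositionalEquality
  using (_≡_; _≢_; refl; sym; trans; cong; cong₂; subst; subst₂; isEquivalence)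
open import Relation.Binary.Structures using (IsStrictTotalOrder)
open import Relation.Nullary using (¬_; Dec; yes; no)
open import Relation.Nullary.Decidable using (map′; decidable-stable; _×-dec_; _⊎-dec_; ¬?)

-- Knotting graphs

mutual
  data Even : ℕ → Set where
    zero : Even zero
    suc  : ∀ {n} → Odd n → Even (suc n)

  data Odd : ℕ → Set where
    suc : ∀ {n} → Even n → Odd (suc n)

even+even : ∀ {m n} → Even m → Even n → Even (m + n)
odd+even  : ∀ {m n} → Odd m → Even n → Odd (m + n)
even+even zero    n = n
even+even (suc m) n = suc (odd+even m n)
odd+even  (suc m) n = suc (even+even m n)

even+odd : ∀ {m n} → Even m → Odd n → Odd (m + n)
odd+odd  : ∀ {m n} → Odd m → Odd n → Even (m + n)
even+odd zero    n = n
even+odd (suc m) n = suc (odd+odd m n)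
odd+odd  (suc m) n = suc (even+odd m n)

parity : ∀ n → Even n ⊎ Odd n
parity zero = inj₁ zero
parity (suc n) with parity n
... | inj₁ even = inj₂ (suc even)
... | inj₂ odd  = inj₁ (suc odd)

¬even×odd : ∀ {n} → Even n → ¬ Odd n
¬even×odd (suc odd) (suc even) = ¬even×odd even odd

even⇒double : ∀ {n} → Even n → ∃ λ k → n ≡ k + k
even⇒double zero = 0 , refl
even⇒double (suc (suc even)) with even⇒double even
... | k , refl = suc k , cong suc (sym (+-suc k k))

module Knotting {A : Set} (H : A → A → Set)
  (H-sym : ∀ {a b} → H a b → H b a)
  (H-irrefl : ∀ {a} → ¬ H a a)
  (H? : ∀ a b → Dec (H a b)) where

  -- Link v a b: a and b lie in one component of the complement of H restricted to the
  -- neighbours of v, i.e. they belong to the same copy of v in Gallai's knotting graph.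
  data Link (v : A) : A → A → Set where
    here : ∀ {a} → H v a → Link v a a
    step : ∀ {a b c} → H v a → ¬ H a b → Link v b c → Link v a c

  link-left : ∀ {v a b} → Link v a b → H v a
  link-left (here va)     = va
  link-left (step va _ _) = va

  link-trans : ∀ {v a b c} → Link v a b → Link v b c → Link v a c
  link-trans (here _)         bc = bc
  link-trans (step va ¬ab ab) bc = step va ¬ab (link-trans ab bc)

  link-sym : ∀ {v a b} → Link v a b → Link v b a
  link-sym (here va) = here va
  link-sym (step va ¬ab ab) =
    link-trans (link-sym ab) (step (link-left ab) (λ ba → ¬ab (H-sym ba)) (here va))

  link-right : ∀ {v a b} → Link v a b → H v b
  link-right ab = link-left (link-sym ab)

  ¬link⇒H : ∀ {v a b} → ¬ Link v a b → H v a → H v b → H a b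
  ¬link⇒H ¬ab va vb = decidable-stable (H? _ _) (λ ¬Hab → ¬ab (step va ¬Hab (here vb)))

  -- Distinct components of a complement graph are completely joined.
  transfer : ∀ {v a b c} → ¬ Link v a b → H v a → Link v b c → Link a b c
  transfer ¬ab va (here vb) = here (¬link⇒H ¬ab va vb)
  transfer ¬ab va bc@(step vb ¬Hbd dc) =
    step (¬link⇒H ¬ab va vb) ¬Hbd
      (transfer (λ ad → ¬ab (link-trans ad (link-sym (step vb ¬Hbd (here (link-left dc)))))) va dc)

  -- Walk n a b c d: a walk with n + 1 edges in the knotting graph, from the edge ab to the edge cd.
  data Walk : ℕ → A → A → A → A → Set where
    []  : ∀ {a b} → Walk zero a b a b
    _∷_ : ∀ {n a b c d e} → Link b a c → Walk n b c d e → Walk (suc n) a b d e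

  infixr 5 _∷_ _++_
  infixl 5 _∷ʳ_

  _++_ : ∀ {m n a b c d e f} → Walk m a b c d → Walk n c d e f → Walk (m + n) a b e f
  []       ++ w′ = w′
  (l ∷ w) ++ w′ = l ∷ (w ++ w′)

  _∷ʳ_ : ∀ {n a b c d e} → Walk n a b c d → Link d c e → Walk (suc n) a b d e
  []      ∷ʳ l = l ∷ []
  (k ∷ w) ∷ʳ l = k ∷ (w ∷ʳ l)

  unsnoc : ∀ {n a b c d} → Walk (suc n) a b c d → ∃ λ e → Walk n a b e c × Link c e d
  unsnoc (l ∷ [])          = _ , [] , l
  unsnoc (l ∷ w@(_ ∷ _)) with unsnoc w
  ... | e , w′ , l′ = e , l ∷ w′ , l′

  reverse : ∀ {n a b c d} → Walk n a b c d → Walk n d c b a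
  reverse []      = []
  reverse (l ∷ w) = reverse w ∷ʳ link-sym l

  -- A turn sees its incoming vertex only up to linking. The index is positive because replacing `a`
  -- in `[]` would alter the last edge as well.
  swap-first : ∀ {n a a′ b c d} → Link b a a′ → Walk (suc n) a b c d → Walk (suc n) a′ b c d
  swap-first aa′ (l ∷ w) = link-trans (link-sym aa′) l ∷ w

  swap-last : ∀ {n a b c d d′} → Link c d d′ → Walk (suc n) a b c d → Walk (suc n) a b c d′
  swap-last dd′ w with unsnoc w
  ... | _ , w′ , l = w′ ∷ʳ link-trans l dd′

  walk₁-open : ∀ {a b} → ¬ Walk 1 a b a b
  walk₁-open (l ∷ []) = H-irrefl (link-left l)

  at : ∀ {n a b c d} → Walk n a b c d → ℕ → A
  at {a = a} w       zero    = a
  -- A walk of index `n` has vertices at positions `0` to `n + 1`; later positions repeat the last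
  -- one.
  at {b = b} []      (suc _) = b
  at         (_ ∷ w) (suc i) = at w i

  at-1 : ∀ {n a b c d} (w : Walk n a b c d) → at w 1 ≡ b
  at-1 []      = refl
  at-1 (_ ∷ _) = refl

  at-length : ∀ {n a b c d} (w : Walk n a b c d) → at w n ≡ c
  at-length []      = refl
  at-length (_ ∷ w) = at-length w

  at-1+length : ∀ {n a b c d} (w : Walk n a b c d) → at w (suc n) ≡ d
  at-1+length []      = refl
  at-1+length (_ ∷ w) = at-1+length w

  at-link : ∀ {n a b c d} (w : Walk n a b c d) {i} → i < n →
    Link (at w (suc i)) (at w i) (at w (suc (suc i)))
  at-link (l ∷ w) {zero}  _ rewrite at-1 w = l
  at-link (l ∷ w) {suc i} (s≤s i<n) = at-link w i<n

  Cut : ∀ {n a b c d} → Walk n a b c d → ℕ → Set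
  Cut {n} {a} {b} {c} {d} w i =
    ∃ λ f → Walk i a b (at w i) f ×
    Σ (Walk (n ∸ i) (at w i) f c d) λ rest → ∀ j → at rest j ≡ at w (i + j)

  cut : ∀ {n a b c d} (w : Walk n a b c d) i → i ≤ n → Cut w i
  cut w       zero    _         = _ , [] , w , λ _ → refl
  cut (l ∷ w) (suc i) (s≤s i≤n) with cut w i i≤n
  ... | f , w₁ , w₂ , w₂-at = f , l ∷ w₁ , w₂ , w₂-at

  -- A closed walk of odd length that visits e twice splits into an odd part
  -- (e, p, …, q, e) and an even part (e, q′, …, p′, e). Follow the odd part e = h 0, p = h 1, … to
  -- the first t with h (t - 1) linked to q at h t. The walk is shortened by the chord from h t to q′
  -- if t is even, and by the chord from h t to q or to e if t is odd.
  module Shortcut {r n : ℕ} {e p p′ q q′ : A}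
    (front : Walk r e p q e) (r-odd : Odd r)
    (back : Walk n e q′ p′ e) (n-even : Even n)
    (qq′ : Link e q q′) (p′p : Link e p′ p)
    (shorter : ∀ {l a b} → Odd l → l < r + suc (suc n) → ¬ Walk l a b a b)
    (¬pq : ¬ Link e p q) where

    back′ : Walk (suc n) e q′ e p
    back′ = back ∷ʳ p′p

    -- The state of the search at the edge `h h′`. At both `q` and `q′`, a vertex in even position
    -- is linked to `e` and one in odd position to `p`; `α` and `β` are `e` and `p` in the order
    -- given by the position of `h`.
    record Front (α β h h′ : A) : Set where
      field
        apart : ¬ Link h h′ q
        ends  : Link h q q′
        αh    : Link q α h
        βh′   : Link q β h′
        αh₁   : Link q′ α h
        βh′₁  : Link q′ β h′
    open Front

    start : Front e p e p
    start .apart = ¬pq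
    start .ends  = qq′
    start .αh    = here (H-sym (link-left qq′))
    start .βh′   = here (H-sym (¬link⇒H ¬pq (link-right p′p) (link-left qq′)))
    start .αh₁   = here (H-sym (link-right qq′))
    start .βh′₁  = here (H-sym (link-right (transfer ¬pq (link-right p′p) qq′)))

    ends′ : ∀ {α β h h′} → Front α β h h′ → H h h′ → Link h′ q q′
    ends′ F hh′ = transfer (F .apart) hh′ (F .ends)

    -- The old `apart` moves the link of `q` and `q′` from `h` to `h′`; that `h` is not linked to
    -- `q` at `h′` moves the link of `h` and `h″` from `h′` to `q` and to `q′`.
    advance : ∀ {α β h h′ h″} → Front α β h h′ → Link h′ h h″ → ¬ Link h′ h q → Front β α h′ h″
    advance {h = h} {h′} {h″} F hh″ ¬hq = record
      { apart = λ h″q → ¬hq (link-trans hh″ h″q)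
      ; ends  = e′
      ; αh    = F .βh′
      ; βh′   = link-trans (F .αh) (transfer (λ l → ¬hq (link-sym l)) (link-left e′) hh″)
      ; αh₁   = F .βh′₁
      ; βh′₁  = link-trans (F .αh₁)
                  (transfer (λ l → ¬hq (link-sym (link-trans e′ l))) (link-right e′) hh″)
      }
      where
      e′ : Link h′ q q′
      e′ = ends′ F (H-sym (link-left hh″))

    module _ (found : ∀ {s k h h′} → Even s → Odd (suc k) → s + suc k ≡ r →
                 Walk s e p h h′ → Walk (suc k) h h′ q e →
                 Link h′ h q → Link q e h → Link q p h′ → ⊥) where

      search-even : ∀ {s k h h′} → Walk s e p h h′ → Walk k h h′ q e → Even s → Odd k →
                    s + k ≡ r → Front e p h h′ → ⊥
      search-odd  : ∀ {s k h h′} → Walk s e p h h′ → Walk k h h′ q e → Odd s → Even k →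
                    s + k ≡ r → Front p e h h′ → ⊥

      search-even w (l ∷ w′) s (suc k) s+k F =
        search-odd (w ∷ʳ l) w′ (suc s) k (trans (sym (+-suc _ _)) s+k)
          (advance F l λ hq → found s (suc k) s+k w (l ∷ w′) hq (F .αh) (F .βh′))
      search-odd w []       s k       s+k F = H-irrefl (link-left (F .ends))
      search-odd {s = s′} w (l ∷ w′) s (suc k) s+k F =
        search-even (w ∷ʳ l) w′ (suc s) k (trans (sym (+-suc _ _)) s+k)
          (advance F l λ hq →
            shorter (even+odd (suc s) (suc n-even)) bound
              ((w ∷ʳ link-trans hq (ends′ F (H-sym (link-left l))))
                ++ swap-first (F .βh′₁) back′))
        where
        bound : suc s′ + suc n < r + suc (suc n)
        bound = +-mono-≤-< (subst (s′ <_) s+k (m<m+n s′ (s≤s z≤n))) (n<1+n (suc n))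

      search : ⊥
      search = search-even [] front zero r-odd refl start

    -- With `e` linked to `p` at `q`, it is also linked there to `h′`, so the tail of `front` from
    -- `h′` to `q` closes up along the chord `q h′`.
    closing : Link q e p → ⊥
    closing ep = search λ {s} {k} s-even k-odd s+k w w′ hq eh ph′ →
      shorter k-odd (≤-trans (s≤s (≤-trans (m≤n+m (suc k) s) (subst (s + suc k ≤_) s+k ≤-refl)))
                      (subst (_≤ r + suc (suc n)) (+-comm r 1) (+-monoʳ-≤ r (s≤s z≤n))))
        (swap-last (link-trans ep ph′) (swap-first hq w′))

    -- Here the chord from `h′` to `e` cuts off the beginning of `front` and `back` is kept. The
    -- hypothesis at `p` excludes stopping at `h′ = p`, where nothing would be cut off.
    skipping : ¬ Link q e p → ¬ Link p e q → ⊥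
    skipping ¬ep ¬eq = search found
      where
      qe : H q e
      qe = H-sym (link-left qq′)
      found : ∀ {s k h h′} → Even s → Odd (suc k) → s + suc k ≡ r →
              Walk s e p h h′ → Walk (suc k) h h′ q e →
              Link h′ h q → Link q e h → Link q p h′ → ⊥
      found zero k-odd s+k [] w′ hq eh ph′ = ¬eq hq
      found {suc s} {k} (suc s-odd) k-odd s+k w w′ hq eh ph′ =
        shorter (odd+even k-odd (suc (suc n-even))) bound
          (swap-last (transfer ¬ep qe ph′)
            ((swap-first (link-sym (transfer (λ l → ¬ep (link-sym (link-trans ph′ l))) (link-right ph′) eh)) w′
              ++ (qq′ ∷ []) ++ back′)))
        where
        bound : suc k + suc (suc n) < r + suc (suc n)
        bound = +-monoˡ-< (suc (suc n)) (subst (suc (suc k) ≤_) s+k (s≤s (m≤n+m (suc k) s)))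

  module _ (distinct⇒⊥ : ∀ {n a b} → Odd n → (w : Walk n a b a b) →
              (∀ {i j} → i < j → j < n → at w i ≢ at w j) → ⊥) where

    Shorter : ℕ → Set
    Shorter n = ∀ {l a b} → Odd l → l < n → ¬ Walk l a b a b

    split : ∀ {r n e p q′} → Odd r → Even n → Shorter (suc r + suc n) →
            Walk (suc r) e p e q′ → Walk (suc n) e q′ e p → ⊥
    split {r} {n} {e} {p} {q′} r-odd n-even shorter w w′ with unsnoc w | unsnoc w′
    ... | q , front , qq′ | p′ , back , p′p = ¬ep→⊥ λ ep → F.closing ep
      where
      shorter′ : Shorter (r + suc (suc n))
      shorter′ = subst Shorter (sym (+-suc r (suc n))) shorter
      -- Otherwise `back` alone would close up, with odd length.
      ¬pq : ¬ Link e p q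
      ¬pq pq = shorter (suc n-even) (s≤s (m≤n+m (suc n) r))
        (back ∷ʳ link-trans p′p (link-trans pq qq′))
      module F = Shortcut front r-odd back n-even qq′ p′p shorter′ ¬pq
      module R = Shortcut (reverse front) r-odd (reverse back) n-even (link-sym p′p) (link-sym qq′)
                   shorter′ (λ qp → ¬pq (link-sym qp))
      -- `R` reads both parts backwards, exchanging `p` and `q`, so its `closing` supplies the
      -- second hypothesis of `F.skipping`. The double negation avoids deciding `Link`.
      ¬ep→⊥ : ¬ ¬ Link q e p
      ¬ep→⊥ ¬ep = F.skipping ¬ep R.closing

    -- Induction on the length: a repeated vertex cuts the closed walk into one part of each parity,
    -- to which `split` applies.
    no-odd-closed : ∀ n → Odd n → ∀ {a b} → ¬ Walk n a b a b
    no-odd-closed = <-rec _ go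
      where
      go : ∀ n → (∀ {l} → l < n → Odd l → ∀ {a b} → ¬ Walk l a b a b) →
           Odd n → ∀ {a b} → ¬ Walk n a b a b
      go n rec n-odd w = distinct⇒⊥ n-odd w repeated
        where
        shorter : Shorter n
        shorter l-odd l<n = rec l<n l-odd
        parts : ∀ {e p q′} k l → k + l ≡ n → 0 < k → 0 < l →
                Walk k e p e q′ → Walk l e q′ e p → ⊥
        parts (suc k) (suc l) refl _ _ w₁ w₂ with parity k | parity l
        ... | inj₁ k-even | inj₁ l-even = ¬even×odd (odd+odd (suc k-even) (suc l-even)) n-odd
        ... | inj₁ k-even | inj₂ l-odd  =
          split l-odd k-even (subst Shorter (+-comm (suc k) (suc l)) shorter) w₂ w₁
        ... | inj₂ k-odd  | inj₁ l-even = split k-odd l-even shorter w₁ w₂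
        ... | inj₂ k-odd  | inj₂ l-odd  = ¬even×odd (even+even (suc k-odd) (suc l-odd)) n-odd
        repeated : ∀ {i j} → i < j → j < n → at w i ≢ at w j
        repeated {i} {j} i<j j<n eq with cut w i (≤-trans (<⇒≤ i<j) (<⇒≤ j<n))
        ... | f , w₁ , w₂ , w₂-at with cut w₂ (j ∸ i) (∸-monoˡ-≤ i (<⇒≤ j<n))
        ...   | f′ , w₃ , w₄ , _ =
          parts (j ∸ i) ((n ∸ i ∸ (j ∸ i)) + i) lengths (m<n⇒0<n∸m i<j)
            (≤-trans (m<n⇒0<n∸m (∸-monoˡ-< j<n i≤j)) (m≤m+n _ i))
            (subst (λ v → Walk _ _ _ v _) same w₃) (subst (λ v → Walk _ v _ _ _) same (w₄ ++ w₁))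
          where
          i≤j = <⇒≤ i<j
          same : at w₂ (j ∸ i) ≡ at w i
          same = trans (w₂-at (j ∸ i)) (trans (cong (at w) (m+[n∸m]≡n i≤j)) (sym eq))
          lengths : (j ∸ i) + ((n ∸ i ∸ (j ∸ i)) + i) ≡ n
          lengths = trans (sym (+-assoc (j ∸ i) _ i))
            (trans (cong (_+ i) (m+[n∸m]≡n (∸-monoˡ-≤ i (<⇒≤ j<n))))
                   (m∸n+n≡m (≤-trans i≤j (<⇒≤ j<n))))

-- Arcs forced by independent edges

-- Warshall's algorithm: Via cs holds of paths all of whose inner points lie in cs.
module _ {A : Set} {R : A → A → Set} where

  Via : List A → A → A → Set
  Via []       a b = R a b
  Via (c ∷ cs) a b = Via cs a b ⊎ (Via cs a c × Via cs c b)

  via? : Decidable R → ∀ cs → Decidable (Via cs)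
  via? R? []       a b = R? a b
  via? R? (c ∷ cs) a b = via? R? cs a b ⊎-dec (via? R? cs a c ×-dec via? R? cs c b)

  via-edge : ∀ cs {a b} → R a b → Via cs a b
  via-edge []       ab = ab
  via-edge (_ ∷ cs) ab = inj₁ (via-edge cs ab)

  via-trans : ∀ cs {a b c} → c ∈ cs → Via cs a c → Via cs c b → Via cs a b
  via-trans (c ∷ cs) (here refl) p q =
    inj₂ ([ id , proj₁ ]′ p , [ id , proj₂ ]′ q)
  via-trans (d ∷ cs) (there c∈) (inj₁ p)        (inj₁ q)        = inj₁ (via-trans cs c∈ p q)
  via-trans (d ∷ cs) (there c∈) (inj₁ p)        (inj₂ (q , q′)) = inj₂ (via-trans cs c∈ p q , q′)
  via-trans (d ∷ cs) (there c∈) (inj₂ (p , p′)) (inj₁ q)        = inj₂ (p , via-trans cs c∈ p′ q)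
  via-trans (d ∷ cs) (there c∈) (inj₂ (p , p′)) (inj₂ (q , q′)) = inj₂ (p , q′)

  via⇒star : ∀ cs {a b} → Via cs a b → Star R a b
  via⇒star []       ab             = ab ◅ ε
  via⇒star (c ∷ cs) (inj₁ ab)      = via⇒star cs ab
  via⇒star (c ∷ cs) (inj₂ (p , q)) = via⇒star cs p ◅◅ via⇒star cs q

  star? : Decidable {A = A} _≡_ → Decidable R → (cs : List A) → (∀ c → c ∈ cs) → Decidable (Star R)
  star? _≟_ R? cs all a b =
    map′ [ (λ { refl → ε }) , via⇒star cs ]′ fold (a ≟ b ⊎-dec via? R? cs a b)
    where
    fold : ∀ {a b} → Star R a b → a ≡ b ⊎ Via cs a b
    fold ε = inj₁ refl
    fold (ab ◅ p) with fold p
    ... | inj₁ refl = inj₂ (via-edge cs ab)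
    ... | inj₂ q    = inj₂ (via-trans cs (all _) (via-edge cs ab) q)

least : ∀ {n} {P : Fin n → Set} → (∀ i → Dec (P i)) → ∃ P → ∃ λ i → P i × ∀ j → P j → toℕ i ≤ toℕ j
least {suc n} {P} P? p with P? zero
... | yes p₀ = zero , p₀ , λ _ _ → z≤n
least {suc n} {P} P? (zero  , p) | no ¬p₀ = ⊥-elim (¬p₀ p)
least {suc n} {P} P? (suc i , p) | no ¬p₀ with least (P? ∘ suc) (i , p)
... | k , pₖ , min = suc k , pₖ , λ { zero p₀ → ⊥-elim (¬p₀ p₀) ; (suc j) pⱼ → s≤s (min j pⱼ) }

-- Independence of xy and x′y′; that x ≢ x′ and y ≢ y′ is implied.
record Cross {X Y : Set} (M : X → Y → Bool) (x x′ : X) (y y′ : Y) : Set where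
  constructor cross
  field
    xy   : M x y ≡ true
    x′y′ : M x′ y′ ≡ true
    xy′  : M x y′ ≡ false
    x′y  : M x′ y ≡ false

complement : {X Y : Set} → (X → Y → Bool) → X → Y → Bool
complement M x y = not (M x y)

Cyclic : {X : Set} → (X → X → Set) → X → X → X → Set
Cyclic _⟶_ a b c = a ⟶ b × b ⟶ c × c ⟶ a

rotate : {X : Set} {R : X → X → Set} {a b c : X} → Cyclic R a b c → Cyclic R b c a
rotate (ab , bc , ca) = bc , ca , ab

-- Two steps `x y z` and `x′ y′ z′` of congruent walks; the closure under `Star` gives the classes
-- of forced arcs in `X`.
TwoStep : {X Y : Set} → (X → Y → Bool) → X × X → X × X → Set
TwoStep M (x , x′) (z , z′) = ∃₂ λ y y′ → Cross M x x′ y y′ × Cross M z z′ y y′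

true≢false : ∀ {b} → b ≡ true → b ≡ false → ⊥
true≢false refl ()

module _ {X Y : Set} {M : X → Y → Bool} where

  cross-swap : ∀ {x x′ y y′} → Cross M x x′ y y′ → Cross M x′ x y′ y
  cross-swap (cross xy x′y′ xy′ x′y) = cross x′y′ xy x′y xy′

  cross-flip : ∀ {x x′ y y′} → Cross M x x′ y y′ → Cross (flip M) y y′ x x′
  cross-flip (cross xy x′y′ xy′ x′y) = cross xy x′y′ x′y xy′

  -- The four pairs are two disjoint edges and two disjoint non-edges; complementing exchanges
  -- these, so `y` and `y′` change places.
  cross-complement : ∀ {x x′ y y′} → Cross M x x′ y y′ → Cross (complement M) x x′ y′ y
  cross-complement (cross xy x′y′ xy′ x′y) =
    cross (cong not xy′) (cong not x′y) (cong not xy) (cong not x′y′)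

  cross-complement⁻ : ∀ {x x′ y y′} → Cross (complement M) x x′ y y′ → Cross M x x′ y′ y
  cross-complement⁻ (cross xy x′y′ xy′ x′y) =
    cross (not-injective xy′) (not-injective x′y) (not-injective xy) (not-injective x′y′)

  twoStep-sym : ∀ {p q} → TwoStep M p q → TwoStep M q p
  twoStep-sym (y , y′ , c , c′) = y , y′ , c′ , c

  twoStep-swap : ∀ {a b c d} → TwoStep M (a , b) (c , d) → TwoStep M (b , a) (d , c)
  twoStep-swap (y , y′ , c , c′) = y′ , y , cross-swap c , cross-swap c′

  twoSteps-sym : ∀ {p q} → Star (TwoStep M) p q → Star (TwoStep M) q p
  twoSteps-sym = Star.reverse λ {p} {q} → twoStep-sym {p} {q}

  twoSteps-swap : ∀ {a b c d} → Star (TwoStep M) (a , b) (c , d) → Star (TwoStep M) (b , a) (d , c)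
  twoSteps-swap = Star.gmap {U = TwoStep M} (λ { (a , b) → b , a }) λ { {_ , _} {_ , _} → twoStep-swap }

  twoStep-complement : ∀ {p q} → TwoStep M p q → TwoStep (complement M) p q
  twoStep-complement (y , y′ , c , c′) = y′ , y , cross-complement c , cross-complement c′

-- The arcs inside X and Y between endpoints of independent edges, in an orientation without
-- forbidden T.
record Coherent {X Y : Set} (M : X → Y → Bool)
  (_⟶ˣ_ : X → X → Set) (_⟶ʸ_ : Y → Y → Set) : Set where
  field
    asymˣ  : ∀ {x x′} → x ⟶ˣ x′ → ¬ x′ ⟶ˣ x
    asymʸ  : ∀ {y y′} → y ⟶ʸ y′ → ¬ y′ ⟶ʸ y
    crossˣ : ∀ {x x′} → x ⟶ˣ x′ → ∃₂ λ y y′ → Cross M x x′ y y′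
    crossʸ : ∀ {y y′} → y ⟶ʸ y′ → ∃₂ λ x x′ → Cross M x x′ y y′
    to     : ∀ {x x′ y y′} → Cross M x x′ y y′ → x ⟶ˣ x′ → y ⟶ʸ y′
    from   : ∀ {x x′ y y′} → Cross M x x′ y y′ → y ⟶ʸ y′ → x ⟶ˣ x′

-- An induced matching `ap`, `bq`, `cr`.
record Triad {X Y : Set} (M : X → Y → Bool) (a b c : X) (p q r : Y) : Set where
  field
    ap : M a p ≡ true
    bq : M b q ≡ true
    cr : M c r ≡ true
    aq : M a q ≡ false
    ar : M a r ≡ false
    bp : M b p ≡ false
    br : M b r ≡ false
    cp : M c p ≡ false
    cq : M c q ≡ false

module _ {X Y : Set} {M : X → Y → Bool} where

  triad-rotate : ∀ {a b c p q r} → Triad M a b c p q r → Triad M b c a q r p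
  triad-rotate t = record
    { ap = bq ; bq = cr ; cr = ap ; aq = br ; ar = bp ; bp = cq ; br = cp ; cp = aq ; cq = ar }
    where open Triad t

  triad-flip : ∀ {a b c p q r} → Triad M a b c p q r → Triad (flip M) p q r a b c
  triad-flip t = record
    { ap = ap ; bq = bq ; cr = cr ; aq = bp ; ar = cp ; bp = aq ; br = cq ; cp = ar ; cq = br }
    where open Triad t

  triad-cross : ∀ {a b c p q r} → Triad M a b c p q r → Cross M a b p q
  triad-cross t = cross ap bq aq bp
    where open Triad t

  mk-triad : ∀ {a b c y z y′ z′} → Cross M b c y z → Cross M c a y′ z′ →
    M a y ≡ false → M a z ≡ false → M b y′ ≡ false → M b z′ ≡ false → Triad M a b c z′ y z
  mk-triad (cross by cz bz cy) (cross cy′ az′ cz′ ay′) ay az by′ bz′ = record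
    { ap = az′ ; bq = by ; cr = cz ; aq = ay ; ar = az ; bp = bz′ ; br = bz ; cp = cz′ ; cq = cy }

-- Cyclic triangles of forced arcs

module _ {X Y : Set} {M : X → Y → Bool} {_⟶ˣ_ : X → X → Set} {_⟶ʸ_ : Y → Y → Set} where

  coherent-flip : Coherent M _⟶ˣ_ _⟶ʸ_ → Coherent (flip M) _⟶ʸ_ _⟶ˣ_
  coherent-flip coh = record
    { asymˣ  = asymʸ
    ; asymʸ  = asymˣ
    ; crossˣ = λ o → let x , x′ , c = crossʸ o in x , x′ , cross-flip c
    ; crossʸ = λ o → let y , y′ , c = crossˣ o in y , y′ , cross-flip c
    ; to     = λ c → from (cross-flip c)
    ; from   = λ c → to (cross-flip c)
    }
    where open Coherent coh

  coherent-complement : Coherent M _⟶ˣ_ _⟶ʸ_ → Coherent (complement M) _⟶ˣ_ (flip _⟶ʸ_)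
  coherent-complement coh = record
    { asymˣ  = asymˣ
    ; asymʸ  = asymʸ
    ; crossˣ = λ o → let y , y′ , c = crossˣ o in y′ , y , cross-complement c
    ; crossʸ = λ o → let x , x′ , c = crossʸ o in x , x′ , cross-complement c
    ; to     = λ c → to (cross-complement⁻ c)
    ; from   = λ c → from (cross-complement⁻ c)
    }
    where open Coherent coh

  module _ (coh : Coherent M _⟶ˣ_ _⟶ʸ_) where
    open Coherent coh

    -- If `a` saw only `y`, then `ay` and `cz` would be independent and `y → z` would force `a → c`;
    -- if only `z`, then `by` and `az` would force `b → a`.
    agree : ∀ {a b c y z} → Cyclic _⟶ˣ_ a b c → Cross M b c y z → M a y ≡ M a z
    agree {a} {y = y} {z} (ab , bc , ca) k@(cross by cz bz cy)
      with M a y in ay | M a z in az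
    ... | true  | true  = refl
    ... | false | false = refl
    ... | true  | false = ⊥-elim (asymˣ ca (from (cross ay cz az cy) (to k bc)))
    ... | false | true  = ⊥-elim (asymˣ ab (from (cross by az bz ay) (to k bc)))

    slide : ∀ {a b c p q r y z} → Cyclic _⟶ˣ_ a b c → Triad M a b c p q r → Cross M b c y z →
      Triad M a b c p y z
    slide {a} {y = y} {z} cyc t k@(cross by cz bz cy) with M a z in az
    -- `bq` and `cz` are independent too, so `a` must treat `q` and `z` alike.
    ... | true  = ⊥-elim (true≢false (trans (agree cyc (cross bq cz bz cq)) az) aq)
      where open Triad t
    ... | false = record
      { ap = ap ; bq = by ; cr = cz ; aq = trans (agree cyc k) az ; ar = az
      ; bp = bp ; br = bz ; cp = cp ; cq = cy }
      where open Triad t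

    cyclic-to : ∀ {a b c p q r} → Triad M a b c p q r → Cyclic _⟶ˣ_ a b c → Cyclic _⟶ʸ_ p q r
    cyclic-to t (ab , bc , ca) =
      to (triad-cross t) ab , to (triad-cross (triad-rotate t)) bc ,
      to (triad-cross (triad-rotate (triad-rotate t))) ca

    -- Two of the three values M a y, M b y′, M c y″ agree.
    classify : ∀ {a b c} → Cyclic _⟶ˣ_ a b c →
      (∃ λ p → ∃₂ λ q r → Triad M a b c p q r) ⊎
      (∃ λ p → ∃₂ λ q r → Triad (complement M) a b c p q r)
    classify {a} {b} {c} cyc@(ab , bc , ca)
      with crossˣ bc | crossˣ ca | crossˣ ab
    ... | y₁ , z₁ , k₁ | y₂ , z₂ , k₂ | y₃ , z₃ , k₃
      with M a y₁ in a₁ | M b y₂ in b₂ | M c y₃ in c₃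
         | agree cyc k₁ | agree (bc , ca , ab) k₂ | agree (ca , ab , bc) k₃
    ... | false | false | _     | a′ | b′ | c′ =
      inj₁ (_ , _ , _ , mk-triad k₁ k₂ a₁ (sym a′) b₂ (sym b′))
    ... | false | true  | false | a′ | b′ | c′ =
      inj₁ (_ , _ , _ , triad-rotate (mk-triad k₃ k₁ c₃ (sym c′) a₁ (sym a′)))
    ... | true  | false | false | a′ | b′ | c′ =
      inj₁ (_ , _ , _ , triad-rotate (triad-rotate (mk-triad k₂ k₃ b₂ (sym b′) c₃ (sym c′))))
    ... | true  | true  | _     | a′ | b′ | c′ =
      inj₂ (_ , _ , _ , mk-triad (cross-complement k₁) (cross-complement k₂)
        (cong not (sym a′)) (cong not a₁) (cong not (sym b′)) (cong not b₂))
    ... | true  | false | true  | a′ | b′ | c′ =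
      inj₂ (_ , _ , _ , triad-rotate (mk-triad (cross-complement k₃) (cross-complement k₁)
        (cong not (sym c′)) (cong not c₃) (cong not (sym a′)) (cong not a₁)))
    ... | false | true  | true  | a′ | b′ | c′ =
      inj₂ (_ , _ , _ , triad-rotate (triad-rotate (mk-triad (cross-complement k₂) (cross-complement k₃)
        (cong not (sym b′)) (cong not b₂) (cong not (sym c′)) (cong not c₃))))

module _ {X Y : Set} where

  -- A two-step is one slide in each part: the first replaces `q` and `r` using the triangle in `X`,
  -- the second replaces `b` and `c` using the triangle in `Y`. Neither `a` nor `p` moves.
  slide* : {M : X → Y → Bool} {_⟶ˣ_ : X → X → Set} {_⟶ʸ_ : Y → Y → Set} →
    Coherent M _⟶ˣ_ _⟶ʸ_ → ∀ {a b c b′ c′ p q r} →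
    Cyclic _⟶ˣ_ a b c → Triad M a b c p q r → Star (TwoStep M) (b , c) (b′ , c′) → Cyclic _⟶ˣ_ a b′ c′
  slide* coh cyc t ε = cyc
  slide* coh cyc t (_◅_ {j = _ , _} (y , z , k , k′) ks) =
    slide* coh (cyclic-to coh′ u cyc′) (triad-flip u) ks
    where
    coh′ = coherent-flip coh
    t′   = slide coh cyc t k
    cyc′ = cyclic-to coh t′ cyc
    u    = slide coh′ cyc′ (triad-flip t′) (cross-flip k′)

  module _ {M : X → Y → Bool} {_⟶ˣ_ : X → X → Set} {_⟶ʸ_ : Y → Y → Set}
    (coh : Coherent M _⟶ˣ_ _⟶ʸ_) where

    -- Cyclic triangles without a triad have one in the bipartite complement,
    -- where independence reverses the arcs of Y.
    opposite : ∀ {a b c b′ c′} → Cyclic _⟶ˣ_ a b c →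
      Star (TwoStep M) (b , c) (b′ , c′) → Cyclic _⟶ˣ_ a b′ c′
    opposite cyc ks with classify coh cyc
    ... | inj₁ (_ , _ , _ , t) = slide* coh cyc t ks
    ... | inj₂ (_ , _ , _ , t) = slide* (coherent-complement coh) cyc t
      (Star.map (λ {p} {q} → twoStep-complement {p = p} {q}) ks)

    cyclic-across : ∀ {a b c} → Cyclic _⟶ˣ_ a b c → ∃ λ p → ∃₂ λ q r → Cyclic _⟶ʸ_ p q r
    cyclic-across cyc with classify coh cyc
    ... | inj₁ (_ , _ , _ , t) = _ , _ , _ , cyclic-to coh t cyc
    ... | inj₂ (_ , _ , _ , t) with cyclic-to (coherent-complement coh) t cyc
    ...   | qp , rq , pr = _ , _ , _ , qp , pr , rq

-- Arcs between vertices with comparable neighbourhoods point to the larger neighbourhood.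
module Completion {n : ℕ} {Y : Set} {M : Fin n → Y → Bool}
  {_⟶ˣ_ : Fin n → Fin n → Set} {_⟶ʸ_ : Y → Y → Set} (coh : Coherent M _⟶ˣ_ _⟶ʸ_)
  (private? : ∀ u v → Dec (∃ λ y → M u y ≡ true × M v y ≡ false))
  (total : ∀ {u v y y′} → Cross M u v y y′ → u ⟶ˣ v ⊎ v ⟶ˣ u)
  (acyclic : ∀ {a b c} → ¬ Cyclic _⟶ˣ_ a b c) where
  open Coherent coh

  _⊑_ : Fin n → Fin n → Set
  u ⊑ v = ∀ y → M u y ≡ true → M v y ≡ true

  -- Vertices with equal neighbourhoods are ordered by index.
  _≺_ : Fin n → Fin n → Set
  u ≺ v = u ⟶ˣ v ⊎ (u ⊑ v × (¬ v ⊑ u ⊎ u Fin.< v))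

  ⊑-trans : ∀ {u v w} → u ⊑ v → v ⊑ w → u ⊑ w
  ⊑-trans uv vw y = vw y ∘ uv y

  ⊑? : ∀ u v → (∃ λ y → M u y ≡ true × M v y ≡ false) ⊎ u ⊑ v
  ⊑? u v with private? u v
  ... | yes p = inj₁ p
  ... | no ¬p = inj₂ sub
    where
    sub : u ⊑ v
    sub y uy with M v y in vy
    ... | true  = refl
    ... | false = ⊥-elim (¬p (y , uy , vy))

  ⊑⇒¬cross : ∀ {u v y y′} → u ⊑ v → ¬ Cross M u v y y′
  ⊑⇒¬cross uv (cross uy _ _ vy) = true≢false (uv _ uy) vy

  ⟶⇒⋣ : ∀ {u v} → u ⟶ˣ v → ¬ v ⊑ u
  ⟶⇒⋣ o vu with crossˣ o
  ... | _ , _ , k = ⊑⇒¬cross vu (cross-swap k)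

  ≺-irrefl : ∀ {u} → ¬ u ≺ u
  ≺-irrefl (inj₁ uu)              = asymˣ uu uu
  ≺-irrefl (inj₂ (uu , inj₁ ¬uu)) = ¬uu uu
  ≺-irrefl (inj₂ (_  , inj₂ u<u)) = Fin.<-irrefl refl u<u

  ≺-asym : ∀ {u v} → u ≺ v → ¬ v ≺ u
  ≺-asym (inj₁ uv) (inj₁ vu) = asymˣ uv vu
  ≺-asym (inj₁ uv) (inj₂ (vu , _)) = ⟶⇒⋣ uv vu
  ≺-asym (inj₂ (uv , _)) (inj₁ vu) = ⟶⇒⋣ vu uv
  ≺-asym (inj₂ (uv , inj₁ ¬vu)) (inj₂ (vu , _)) = ¬vu vu
  ≺-asym (inj₂ (uv , _)) (inj₂ (vu , inj₁ ¬uv)) = ¬uv uv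
  ≺-asym (inj₂ (_ , inj₂ u<v)) (inj₂ (_ , inj₂ v<u)) = Fin.<-irrefl refl (Fin.<-trans u<v v<u)

  ≺-total : ∀ u v → u ≢ v → u ≺ v ⊎ v ≺ u
  ≺-total u v u≢v with ⊑? u v | ⊑? v u
  ... | inj₁ (_ , uy , vy) | inj₁ (_ , vy′ , uy′) =
    [ inj₁ ∘ inj₁ , inj₂ ∘ inj₁ ]′ (total (cross uy vy′ uy′ vy))
  ... | inj₁ (_ , uy , vy) | inj₂ vu = inj₂ (inj₂ (vu , inj₁ λ uv → true≢false (uv _ uy) vy))
  ... | inj₂ uv | inj₁ (_ , vy , uy) = inj₁ (inj₂ (uv , inj₁ λ vu → true≢false (vu _ vy) uy))
  ... | inj₂ uv | inj₂ vu with Fin.<-cmp u v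
  ...   | tri< u<v _ _ = inj₁ (inj₂ (uv , inj₂ u<v))
  ...   | tri≈ _ u≡v _ = ⊥-elim (u≢v u≡v)
  ...   | tri> _ _ v<u = inj₂ (inj₂ (vu , inj₂ v<u))

  -- If N(a) ⊆ N(b), then ca and cb are forced to agree.
  one-inclusion : ∀ {a b c} → a ⊑ b → b ⟶ˣ c → ¬ c ⟶ˣ a
  one-inclusion {a} {b} {c} ab bc ca with crossˣ bc | crossˣ ca
  ... | y , z , cross by cz bz cy | w , s , k@(cross cw as cs aw) with M a z in az
  ...   | true  = true≢false (ab z az) bz
  ...   | false = asymˣ bc (from (cross cz (ab s as) cs bz) (to (cross cz as cs az) ca))

  two-inclusions : ∀ {a b c} → a ⊑ b → b ⊑ c → ¬ c ⟶ˣ a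
  two-inclusions ab bc ca = ⟶⇒⋣ ca (⊑-trans ab bc)

  ≺-acyclic : ∀ {a b c} → ¬ Cyclic _≺_ a b c
  ≺-acyclic (inj₁ ab , inj₁ bc , inj₁ ca) = acyclic (ab , bc , ca)
  ≺-acyclic (inj₂ (ab , _) , inj₁ bc , inj₁ ca) = one-inclusion ab bc ca
  ≺-acyclic (inj₁ ab , inj₂ (bc , _) , inj₁ ca) = one-inclusion bc ca ab
  ≺-acyclic (inj₁ ab , inj₁ bc , inj₂ (ca , _)) = one-inclusion ca ab bc
  ≺-acyclic (inj₂ (ab , _) , inj₂ (bc , _) , inj₁ ca) = two-inclusions ab bc ca
  ≺-acyclic (inj₂ (ab , _) , inj₁ bc , inj₂ (ca , _)) = two-inclusions ca ab bc
  ≺-acyclic (inj₁ ab , inj₂ (bc , _) , inj₂ (ca , _)) = two-inclusions bc ca ab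
  ≺-acyclic (inj₂ (ab , inj₁ ¬ba) , inj₂ (bc , _) , inj₂ (ca , _)) = ¬ba (⊑-trans bc ca)
  ≺-acyclic (inj₂ (ab , _) , inj₂ (bc , inj₁ ¬cb) , inj₂ (ca , _)) = ¬cb (⊑-trans ca ab)
  ≺-acyclic (inj₂ (ab , _) , inj₂ (bc , _) , inj₂ (ca , inj₁ ¬ac)) = ¬ac (⊑-trans ab bc)
  ≺-acyclic (inj₂ (_ , inj₂ a<b) , inj₂ (_ , inj₂ b<c) , inj₂ (_ , inj₂ c<a)) =
    Fin.<-irrefl refl (Fin.<-trans a<b (Fin.<-trans b<c c<a))

  ≺-isStrictTotalOrder : IsStrictTotalOrder _≡_ _≺_
  ≺-isStrictTotalOrder = record
    { isStrictPartialOrder = record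
      { isEquivalence = isEquivalence
      ; irrefl        = λ { refl → ≺-irrefl }
      ; trans         = ≺-trans
      ; <-resp-≈      = (λ { refl → id }) , λ { refl → id }
      }
    ; compare = compare
    }
    where
    compare : Trichotomous _≡_ _≺_
    compare u v with u ≟ v
    ... | yes refl = tri≈ ≺-irrefl refl ≺-irrefl
    ... | no u≢v with ≺-total u v u≢v
    ...   | inj₁ uv = tri< uv u≢v (≺-asym uv)
    ...   | inj₂ vu = tri> (≺-asym vu) u≢v vu
    -- A tournament without cyclic triangles is transitive.
    ≺-trans : ∀ {u v w} → u ≺ v → v ≺ w → u ≺ w
    ≺-trans {u} {v} {w} uv vw with compare u w
    ... | tri< uw _ _   = uw
    ... | tri≈ _ refl _ = ⊥-elim (≺-asym uv vw)
    ... | tri> _ _ wu   = ⊥-elim (≺-acyclic (uv , vw , wu))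

-- Among the pairs of a class and of its reverse, the lexicographically first one is an arc.
module Lexicographic {m n : ℕ} (M : Fin m → Fin n → Bool)
  (irreversible : ∀ {u v y y′} → Cross M u v y y′ → ¬ Star (TwoStep M) (u , v) (v , u)) where

  infix 4 _∼_ _⟶ˣ_ _⟶ʸ_

  _∼_ : Fin m × Fin m → Fin m × Fin m → Set
  _∼_ = Star (TwoStep M)

  cross? : ∀ u v y y′ → Dec (Cross M u v y y′)
  cross? u v y y′ =
    map′ (λ { (a , b , c , d) → cross a b c d }) (λ { (cross a b c d) → a , b , c , d })
      (M u y ≟ᵇ true ×-dec M v y′ ≟ᵇ true ×-dec M u y′ ≟ᵇ false ×-dec M v y ≟ᵇ false)

  _∼?_ : Decidable _∼_
  _∼?_ = star? (≡-dec _≟_ _≟_)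
    (λ { (u , v) (w , z) → any? λ y → any? λ y′ → cross? u v y y′ ×-dec cross? w z y y′ })
    (cartesianProduct (allFin m) (allFin m))
    (λ { (u , v) → ∈-cartesianProduct⁺ (∈-allFin u) (∈-allFin v) })

  code : Fin m × Fin m → ℕ
  code (i , j) = toℕ (combine i j)

  _⟶ˣ_ : Fin m → Fin m → Set
  u ⟶ˣ v = (∃₂ λ y y′ → Cross M u v y y′) ×
    ∃ λ p → p ∼ (u , v) × (∀ q → q ∼ (u , v) ⊎ q ∼ (v , u) → code p ≤ code q)

  _⟶ʸ_ : Fin n → Fin n → Set
  y ⟶ʸ y′ = ∃₂ λ x x′ → Cross M x x′ y y′ × x ⟶ˣ x′

  code-injective : ∀ {p q} → code p ≡ code q → p ≡ q
  code-injective {i , j} {k , l} eq with combine-injective i j k l (toℕ-injective eq)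
  ... | refl , refl = refl

  total : ∀ {u v y y′} → Cross M u v y y′ → u ⟶ˣ v ⊎ v ⟶ˣ u
  total {u} {v} k with least {P = λ c → remQuot {m} m c ∼ (u , v) ⊎ remQuot {m} m c ∼ (v , u)}
    (λ c → (remQuot {m} m c ∼? (u , v)) ⊎-dec (remQuot {m} m c ∼? (v , u)))
    (combine u v , inj₁ (subst (_∼ (u , v)) (sym (remQuot-combine u v)) ε))
  ... | c , c∼ , min = choose c∼
    where
    p = remQuot {m} m c
    code-p : code p ≡ toℕ c
    code-p = cong toℕ (combine-remQuot {m} m c)
    min′ : ∀ q → q ∼ (u , v) ⊎ q ∼ (v , u) → code p ≤ code q
    min′ q@(i , j) q∼ rewrite code-p =
      min (combine i j) (subst (λ q → q ∼ (u , v) ⊎ q ∼ (v , u)) (sym (remQuot-combine i j)) q∼)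
    choose : p ∼ (u , v) ⊎ p ∼ (v , u) → u ⟶ˣ v ⊎ v ⟶ˣ u
    choose (inj₁ p∼) = inj₁ ((_ , _ , k) , p , p∼ , min′)
    choose (inj₂ p∼) = inj₂ ((_ , _ , cross-swap k) , p , p∼ , λ q → min′ q ∘ ⊎-swap)

  -- Both arcs would have the same first pair, which would join the class of `(u , v)` to its
  -- reverse.
  ⟶-asym : ∀ {u v} → u ⟶ˣ v → ¬ v ⟶ˣ u
  ⟶-asym ((_ , _ , k) , p , p∼ , p-min) (_ , q , q∼ , q-min)
    with code-injective {p} {q} (≤-antisym (p-min q (inj₂ q∼)) (q-min p (inj₂ p∼)))
  ... | refl = irreversible k (twoSteps-sym p∼ ◅◅ q∼)

  ⟶-resp-∼ : ∀ {u v w z} → (∃₂ λ y y′ → Cross M w z y y′) → (u , v) ∼ (w , z) → u ⟶ˣ v → w ⟶ˣ z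
  ⟶-resp-∼ k uv∼wz (_ , p , p∼ , min) = k , p , p∼ ◅◅ uv∼wz ,
    λ { q (inj₁ q∼) → min q (inj₁ (q∼ ◅◅ twoSteps-sym uv∼wz))
      ; q (inj₂ q∼) → min q (inj₂ (q∼ ◅◅ twoSteps-swap (twoSteps-sym uv∼wz))) }

  coherent : Coherent M _⟶ˣ_ _⟶ʸ_
  coherent = record
    { asymˣ  = ⟶-asym
    ; asymʸ  = λ { (_ , _ , k , o) (_ , _ , k′ , o′) → ⟶-asym o (across k′ (cross-swap k) o′) }
    ; crossˣ = proj₁
    ; crossʸ = λ { (x , x′ , k , _) → x , x′ , k }
    ; to     = λ k o → _ , _ , k , o
    ; from   = λ { k (_ , _ , k′ , o) → across k′ k o }
    }
    where
    across : ∀ {u v w z y y′} → Cross M u v y y′ → Cross M w z y y′ → u ⟶ˣ v → w ⟶ˣ z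
    across k k′ = ⟶-resp-∼ (_ , _ , k′) ((_ , _ , k , k′) ◅ ε)

  code-≤⇒< : ∀ {i j u v} → code (i , j) ≤ code (u , v) → i ≢ u → i Fin.< u
  code-≤⇒< {i} {j} {u} {v} le i≢u with Fin.<-cmp i u
  ... | tri< i<u _ _ = i<u
  ... | tri≈ _ i≡u _ = ⊥-elim (i≢u i≡u)
  ... | tri> _ _ u<i = ⊥-elim (<⇒≱ (combine-monoˡ-< v j u<i) le)

  -- The first pair (i , j) of the class of (c , a) forms a cyclic triangle with b, and i ≤ a.
  acyclicˣ : ∀ {a b c} → ¬ Cyclic _⟶ˣ_ a b c
  acyclicˣ {a} = go (<-wellFounded a)
    where
    go : ∀ {a b c} → Acc Fin._<_ a → ¬ Cyclic _⟶ˣ_ a b c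
    go {a} {b} {c} (acc rec) cyc@(ab , bc , ca@(_ , (i , j) , ij∼ca , min)) with i ≟ a
    ... | yes refl = ⟶-asym ab (proj₁ bij)
      where
      bij : Cyclic _⟶ˣ_ b i j
      bij = opposite coherent (rotate {R = _⟶ˣ_} cyc) (twoSteps-sym ij∼ca)
    -- Comparison with the reverse pair `(a , c)`, whose first entry is `a`, gives `i ≤ a`.
    ... | no i≢a = go (rec (code-≤⇒< (min (a , c) (inj₂ ε)) i≢a)) (rotate {R = _⟶ˣ_} bij)
      where
      bij : Cyclic _⟶ˣ_ b i j
      bij = opposite coherent (rotate {R = _⟶ˣ_} cyc) (twoSteps-sym ij∼ca)

  acyclicʸ : ∀ {p q r} → ¬ Cyclic _⟶ʸ_ p q r
  acyclicʸ cyc with cyclic-across (coherent-flip coherent) cyc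
  ... | _ , _ , _ , cycˣ = acyclicˣ cycˣ

  totalʸ : ∀ {y y′ x x′} → Cross (flip M) y y′ x x′ → y ⟶ʸ y′ ⊎ y′ ⟶ʸ y
  totalʸ k with total (cross-flip k)
  ... | inj₁ o = inj₁ (_ , _ , cross-flip k , o)
  ... | inj₂ o = inj₂ (_ , _ , cross-swap (cross-flip k) , o)

  module CX = Completion coherent
    (λ u v → any? λ y → M u y ≟ᵇ true ×-dec M v y ≟ᵇ false) total acyclicˣ
  module CY = Completion (coherent-flip coherent)
    (λ u v → any? λ x → M x u ≟ᵇ true ×-dec M x v ≟ᵇ false) totalʸ acyclicʸ

  -- An inclusion of neighbourhoods in either part contradicts independence; if both arcs are
  -- forced, `u → v` forces `z → w`.
  no-T : ∀ {u v w z} → u CX.≺ v → w CY.≺ z → ¬ Cross M u v z w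
  no-T (inj₂ (uv , _)) _ k = CX.⊑⇒¬cross uv k
  no-T (inj₁ _) (inj₂ (wz , _)) k = CY.⊑⇒¬cross wz (cross-flip (cross-swap k))
  no-T (inj₁ uv) (inj₁ wz) k = Coherent.asymʸ coherent wz (Coherent.to coherent k uv)

-- Bigraphs

*-%ʳ : ∀ x y N → (x * (y % suc N)) % suc N ≡ (x * y) % suc N
*-%ʳ x y N = trans (%-distribˡ-* x (y % suc N) (suc N))
  (trans (cong (λ z → (x % suc N * z) % suc N) (m%n%n≡m%n y (suc N))) (sym (%-distribˡ-* x y (suc N))))

+-%-cong : ∀ c {a b} N → a % suc N ≡ b % suc N → (c + a) % suc N ≡ (c + b) % suc N
+-%-cong c {a} {b} N eq = trans (%-distribˡ-+ c a (suc N))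
  (trans (cong (λ z → (c % suc N + z) % suc N) eq) (sym (%-distribˡ-+ c b (suc N))))

-- 2 has the inverse k + 1 modulo 2k + 1.
double-%-injective : ∀ k {i j} → i < suc (k + k) → j < suc (k + k) →
  (2 * i) % suc (k + k) ≡ (2 * j) % suc (k + k) → i ≡ j
double-%-injective k i< j< eq = trans (halve i<) (trans (cong (λ z → (suc k * z) % N) eq) (sym (halve j<)))
  where
  N = suc (k + k)
  halve : ∀ {i} → i < N → i ≡ (suc k * ((2 * i) % N)) % N
  halve {i} i< = sym (trans (*-%ʳ (suc k) (2 * i) (k + k))
    (trans (cong (_% N) (solve 2 (λ k i → (con 1 :+ k) :* (con 2 :* i) := i :+ i :* (con 1 :+ (k :+ k))) refl k i))
    (trans ([m+kn]%n≡m%n i i N) (m<n⇒m%n≡m i<))))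
    where open +-*-Solver

module _ {m n : ℕ} (G : BiGraph m n) where

  -- Both (iv) and (vi) lead to (i) through this condition.
  Irreversible : Set
  Irreversible = ∀ {u v y y′} → Cross G u v y y′ → ¬ Star (TwoStep G) (u , v) (v , u)

  E⇒≡ : ∀ {x y} → E G x y → G x y ≡ true
  E⇒≡ = Equivalence.to T-≡

  ≡⇒E : ∀ {x y} → G x y ≡ true → E G x y
  ≡⇒E = Equivalence.from T-≡

  ¬E⇒≡ : ∀ {x y} → ¬ E G x y → G x y ≡ false
  ¬E⇒≡ {x} {y} ¬xy with G x y
  ... | true  = ⊥-elim (¬xy _)
  ... | false = refl

  ≡⇒¬E : ∀ {x y} → G x y ≡ false → ¬ E G x y
  ≡⇒¬E eq xy = true≢false (E⇒≡ xy) eq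

  mk-indep : ∀ {x y x′ y′} → E G x y → E G x′ y′ → ¬ E G x y′ → ¬ E G x′ y → Indep G x y x′ y′
  mk-indep xy x′y′ ¬xy′ ¬x′y = xy , x′y′ , (λ { refl → ¬x′y xy }) , (λ { refl → ¬xy′ xy }) , ¬xy′ , ¬x′y

  cross⇒indep : ∀ {x x′ y y′} → Cross G x x′ y y′ → Indep G x y x′ y′
  cross⇒indep (cross xy x′y′ xy′ x′y) = mk-indep (≡⇒E xy) (≡⇒E x′y′) (≡⇒¬E xy′) (≡⇒¬E x′y)

  indep-sym : ∀ {x y x′ y′} → Indep G x y x′ y′ → Indep G x′ y′ x y
  indep-sym (xy , x′y′ , _ , _ , ¬xy′ , ¬x′y) = mk-indep x′y′ xy ¬x′y ¬xy′

  adj-sym : ∀ {a b} → Adj G a b → Adj G b a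
  adj-sym {inj₁ _} {inj₂ _} ab = ab
  adj-sym {inj₂ _} {inj₁ _} ab = ab

  edgeXY⇒adj : ∀ {a b x y} → EdgeXY G a b x y → E G x y → Adj G a b
  edgeXY⇒adj (inj₁ (refl , refl)) xy = xy
  edgeXY⇒adj (inj₂ (refl , refl)) xy = xy

  indepV-sym : ∀ {a a′ b b′} → IndepV G a a′ b b′ → IndepV G b b′ a a′
  indepV-sym (_ , _ , _ , _ , e , e′ , i) = _ , _ , _ , _ , e′ , e , indep-sym i

  -- Orderings, orientations and invertible pairs

  irreversible⇒cocomparability : Irreversible → CocomparabilityBigraph G
  irreversible⇒cocomparability irr =
    CX._≺_ , CY._≺_ , CX.≺-isStrictTotalOrder , CY.≺-isStrictTotalOrder , λ u v w z → free {u} {v} {w} {z}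
    where
    open Lexicographic G irr
    free : ∀ {u v w z} → u CX.≺ v → w CY.≺ z → E G u z → E G v w → E G u w ⊎ E G v z
    free {u} {v} {w} {z} uv wz uz vw with T? (G u w) | T? (G v z)
    ... | yes uw | _      = inj₁ uw
    ... | no _   | yes vz = inj₂ vz
    ... | no ¬uw | no ¬vz = ⊥-elim (no-T uv wz (cross (E⇒≡ uz) (E⇒≡ vw) (¬E⇒≡ ¬uw) (¬E⇒≡ ¬vz)))

  cocomparability⇒acyclic-T-free : CocomparabilityBigraph G →
    Σ (Orientation G) λ o → Acyclic G o × TFree G o
  cocomparability⇒acyclic-T-free (_≺ˣ_ , _≺ʸ_ , X , Y , free) =
    record { arcX = _≺ˣ_ ; arcY = _≺ʸ_ ; tourX = tour X ; tourY = tour Y } ,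
    ((λ _ → IsStrictTotalOrder.irrefl X refl ∘ shorten X) ,
     (λ _ → IsStrictTotalOrder.irrefl Y refl ∘ shorten Y)) ,
    λ { (x , x′ , y , y′ , ¬xy , ¬x′y′ , xy′ , x′y , xx′ , yy′) →
        [ ¬xy , ¬x′y′ ]′ (free x x′ y y′ xx′ yy′ xy′ x′y) }
    where
    tour : ∀ {A : Set} {_<_ : A → A → Set} → IsStrictTotalOrder _≡_ _<_ → IsTournament G _<_
    tour {_<_ = _<_} O = (λ _ → irrefl refl) , orient
      where
      open IsStrictTotalOrder O
      orient : ∀ a b → a ≢ b → (a < b × ¬ b < a) ⊎ (b < a × ¬ a < b)
      orient a b a≢b with compare a b
      ... | tri< a<b _ ¬b<a = inj₁ (a<b , ¬b<a)
      ... | tri≈ _ a≡b _    = ⊥-elim (a≢b a≡b)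
      ... | tri> ¬a<b _ b<a = inj₂ (b<a , ¬a<b)
    shorten : ∀ {A : Set} {_<_ : A → A → Set} → IsStrictTotalOrder _≡_ _<_ →
      ∀ {a b} → TransClosure _<_ a b → a < b
    shorten O [ ab ]    = ab
    shorten O (ab ∷ bc) = IsStrictTotalOrder.trans O ab (shorten O bc)

  -- The walks of an invertible pair carry whichever arc joins `u` and `v` into its reverse.
  T-free⇒¬invertible : Σ (Orientation G) (TFree G) → ¬ HasInvertiblePair G
  T-free⇒¬invertible (o , T-free) (u , v , u≢v , k , a , b , _ , _ , refl , aₖ , b₀ , bₖ , same , indep) =
    [ (λ uv → Arc-asym u v uv
        (subst₂ Arc aₖ bₖ (along k a b indep (subst (Arc u) (sym b₀) uv))))
    , (λ vu → Arc-asym v u vu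
        (subst₂ Arc bₖ aₖ (along k b a (indepV-sym ∘ indep) (subst (λ b → Arc b u) (sym b₀) vu))))
    ]′ (Arc-total u v (trans same (cong (inX G) b₀)) u≢v)
    where
    Arc : V G → V G → Set
    Arc (inj₁ x) (inj₁ x′) = arcX o x x′
    Arc (inj₂ y) (inj₂ y′) = arcY o y y′
    Arc _        _         = ⊥
    tour-asym : ∀ {A : Set} {R : A → A → Set} → IsTournament G R → ∀ {a b} → R a b → ¬ R b a
    tour-asym (irrefl , orient) {a} {b} ab ba with orient a b (λ { refl → irrefl a ab })
    ... | inj₁ (_ , ¬ba) = ¬ba ba
    ... | inj₂ (_ , ¬ab) = ¬ab ab
    Arc-asym : ∀ a b → Arc a b → ¬ Arc b a
    Arc-asym (inj₁ _) (inj₁ _) = tour-asym (tourX o)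
    Arc-asym (inj₂ _) (inj₂ _) = tour-asym (tourY o)
    Arc-total : ∀ a b → SamePart G a b → a ≢ b → Arc a b ⊎ Arc b a
    Arc-total (inj₁ a) (inj₁ b) _ a≢b with proj₂ (tourX o) a b (a≢b ∘ cong inj₁)
    ... | inj₁ (ab , _) = inj₁ ab
    ... | inj₂ (ba , _) = inj₂ ba
    Arc-total (inj₂ a) (inj₂ b) _ a≢b with proj₂ (tourY o) a b (a≢b ∘ cong inj₂)
    ... | inj₁ (ab , _) = inj₁ ab
    ... | inj₂ (ba , _) = inj₂ ba
    force : ∀ {a a′ b b′} → IndepV G a a′ b b′ → Arc a b → Arc a′ b′
    force (x , y , x′ , y′ , inj₁ (refl , refl) , inj₁ (refl , refl) , xy , x′y′ , _ , y≢y′ , ¬xy′ , ¬x′y) xx′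
      with proj₂ (tourY o) y y′ y≢y′
    ... | inj₁ (yy′ , _) = yy′
    ... | inj₂ (y′y , _) = ⊥-elim (T-free (x , x′ , y′ , y , ¬xy′ , ¬x′y , xy , x′y′ , xx′ , y′y))
    force (x , y , x′ , y′ , inj₂ (refl , refl) , inj₂ (refl , refl) , xy , x′y′ , x≢x′ , _ , ¬xy′ , ¬x′y) yy′
      with proj₂ (tourX o) x x′ x≢x′
    ... | inj₁ (xx′ , _) = xx′
    ... | inj₂ (x′x , _) = ⊥-elim (T-free (x′ , x , y , y′ , ¬x′y , ¬xy′ , x′y′ , xy , x′x , yy′))
    force (_ , _ , _ , _ , inj₁ (refl , refl) , inj₂ (refl , refl) , _) ()
    force (_ , _ , _ , _ , inj₂ (refl , refl) , inj₁ (refl , refl) , _) ()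
    along : ∀ k (a b : Fin (suc k) → V G) →
      (∀ i → IndepV G (a (inject₁ i)) (a (suc i)) (b (inject₁ i)) (b (suc i))) →
      Arc (a zero) (b zero) → Arc (a (fromℕ k)) (b (fromℕ k))
    along zero    a b indep ab = ab
    along (suc k) a b indep ab = along k (a ∘ suc) (b ∘ suc) (indep ∘ suc) (force (indep zero) ab)

  CongruentWalks : V G → V G → V G → V G → Set
  CongruentWalks u v u′ v′ = ∃ λ k → Σ (Fin (suc k) → V G) λ a → Σ (Fin (suc k) → V G) λ b →
    a zero ≡ u × a (fromℕ k) ≡ u′ × b zero ≡ v × b (fromℕ k) ≡ v′ ×
    (∀ i → IndepV G (a (inject₁ i)) (a (suc i)) (b (inject₁ i)) (b (suc i)))

  extend : ∀ {u v w z u′ v′} → IndepV G u w v z → CongruentWalks w z u′ v′ → CongruentWalks u v u′ v′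
  extend {u} {v} uwvz (k , a , b , refl , aₖ , refl , bₖ , indep) =
    suc k , u ◂ a , v ◂ b , refl , aₖ , refl , bₖ , λ { zero → uwvz ; (suc i) → indep i }

  twoSteps⇒walks : ∀ {u v u′ v′} → Star (TwoStep G) (u , v) (u′ , v′) →
    CongruentWalks (inj₁ u) (inj₁ v) (inj₁ u′) (inj₁ v′)
  twoSteps⇒walks {u} {v} ε =
    0 , (λ _ → inj₁ u) , (λ _ → inj₁ v) , refl , refl , refl , refl , λ ()
  twoSteps⇒walks (_◅_ {j = _ , _} (y , y′ , k , k′) ks) =
    extend (_ , _ , _ , _ , inj₁ (refl , refl) , inj₁ (refl , refl) , cross⇒indep k)
      (extend (_ , _ , _ , _ , inj₂ (refl , refl) , inj₂ (refl , refl) , cross⇒indep k′)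
        (twoSteps⇒walks ks))

  ¬invertible⇒irreversible : ¬ HasInvertiblePair G → Irreversible
  ¬invertible⇒irreversible ¬inv {u} {v} (cross uy _ _ vy) ks with twoSteps⇒walks ks
  ... | k , a , b , a₀ , aₖ , b₀ , bₖ , indep =
    ¬inv (inj₁ u , inj₁ v , (λ { refl → true≢false uy vy }) , k , a , b ,
      (λ i → let _ , _ , _ , _ , e , _ , xy , _ = indep i in edgeXY⇒adj e xy) ,
      (λ i → let _ , _ , _ , _ , _ , e , _ , xy , _ = indep i in edgeXY⇒adj e xy) ,
      a₀ , aₖ , b₀ , bₖ , trans (cong (inX G) a₀) (cong (inX G) (sym b₀)) , indep)

  -- Transitive orientations of `I(G)` and weak edge-asteroids

  cocomparability⇒IG-comparability : CocomparabilityBigraph G → IGComparability G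
  cocomparability⇒IG-comparability (_≺ˣ_ , _≺ʸ_ , X , Y , free) =
    _⟶_ , (λ _ _ → proj₁) , orient , (λ _ _ (_ , ef) (_ , fe) → X.asym ef fe) , ⟶-trans
    where
    module X = IsStrictTotalOrder X
    module Y = IsStrictTotalOrder Y
    _⟶_ : EdgeOf G → EdgeOf G → Set
    e@((x , _) , _) ⟶ f@((x′ , _) , _) = IndepEdges G e f × x ≺ˣ x′
    orient : ∀ e f → IndepEdges G e f → e ⟶ f ⊎ f ⟶ e
    orient ((x , _) , _) ((x′ , _) , _) ef@(_ , _ , x≢x′ , _) with X.compare x x′
    ... | tri< xx′ _ _   = inj₁ (ef , xx′)
    ... | tri≈ _ x≡x′ _ = ⊥-elim (x≢x′ x≡x′)
    ... | tri> _ _ x′x   = inj₂ (indep-sym ef , x′x)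
    ≺ʸ-from : ∀ {x y x′ y′} → Indep G x y x′ y′ → x ≺ˣ x′ → y ≺ʸ y′
    ≺ʸ-from {x} {y} {x′} {y′} (xy , x′y′ , _ , y≢y′ , ¬xy′ , ¬x′y) xx′ with Y.compare y y′
    ... | tri< yy′ _ _  = yy′
    ... | tri≈ _ y≡y′ _ = ⊥-elim (y≢y′ y≡y′)
    ... | tri> _ _ y′y  = ⊥-elim ([ ¬xy′ , ¬x′y ]′ (free x x′ y′ y xx′ y′y xy x′y′))
    ⟶-trans : ∀ e f g → e ⟶ f → f ⟶ g → e ⟶ g
    ⟶-trans ((x , y) , xy) ((x′ , y′) , x′y′) ((x″ , y″) , x″y″)
      (ef@(_ , _ , _ , _ , ¬xy′ , ¬x′y) , xx′) (fg@(_ , _ , _ , _ , ¬x′y″ , ¬x″y′) , x′x″) =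
      -- By `free`, an edge `xy″` or `x″y` taken with `x′y′` would yield an edge that independence
      -- from the middle edge excludes.
      mk-indep xy x″y″
        (λ xy″ → [ ¬xy′ , ¬x′y″ ]′ (free x x′ y′ y″ xx′ (≺ʸ-from fg x′x″) xy″ x′y′))
        (λ x″y → [ ¬x′y , ¬x″y′ ]′ (free x′ x″ y y′ x′x″ (≺ʸ-from ef xx′) x′y′ x″y)) ,
      X.trans xx′ x′x″

  Avoids : EdgeOf G → V G → Set
  Avoids ((x , y) , _) v = ¬ Adj G v (inj₁ x) × ¬ Adj G v (inj₂ y)

  Covers : {l : ℕ} → (Fin (suc l) → V G) → EdgeOf G → Set
  Covers w ((x , y) , _) = Occurs G w (inj₁ x) × Occurs G w (inj₂ y)

  opposite-orientation : IGComparability G → IGComparability G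
  opposite-orientation (O , ⊆-indep , total , asym , O-trans) =
    flip O , (λ e f fe → indep-sym (⊆-indep f e fe)) , (λ e f ef → ⊎-swap (total e f ef)) ,
    (λ e f fe ef → asym f e fe ef) , λ e f g fe gf → O-trans g f e gf fe

  Ends : EdgeOf G → V G → Set
  Ends ((x , y) , _) v = v ≡ inj₁ x ⊎ v ≡ inj₂ y

  avoids⇒indep : ∀ e f {v w} → Adj G v w → Ends f v → Ends f w →
    Avoids e v → Avoids e w → IndepEdges G e f
  avoids⇒indep (_ , e) (_ , f) _ (inj₁ refl) (inj₂ refl) (_ , av) (aw , _) = mk-indep e f aw av
  avoids⇒indep (_ , e) (_ , f) _ (inj₂ refl) (inj₁ refl) (av , _) (_ , aw) = mk-indep e f av aw
  avoids⇒indep _ _ () (inj₁ refl) (inj₁ refl)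
  avoids⇒indep _ _ () (inj₂ refl) (inj₂ refl)

  covers⇒indep : ∀ e f {l} {w : Fin (suc l) → V G} → (∀ j → Avoids e (w j)) → Covers w f → IndepEdges G e f
  covers⇒indep e f@(_ , xy) av ((i , wi) , (j , wj)) = avoids⇒indep e f xy (inj₁ refl) (inj₂ refl)
    (subst (Avoids e) wi (av i)) (subst (Avoids e) wj (av j))

  module _ (C : IGComparability G) where
    private
      O = proj₁ C
      ⊆-indep = proj₁ (proj₂ C)
      total = proj₁ (proj₂ (proj₂ C))
      O-trans = proj₂ (proj₂ (proj₂ (proj₂ C)))

    shared-end : ∀ {f g v} → Ends f v → Ends g v → ¬ IndepEdges G f g
    shared-end (inj₁ refl) (inj₁ refl) (_ , _ , x≢x , _)     = x≢x refl
    shared-end (inj₂ refl) (inj₂ refl) (_ , _ , _ , y≢y , _) = y≢y refl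

    FromAt : EdgeOf G → V G → Set
    FromAt e v = ∀ {f} → Ends f v → IndepEdges G e f → O e f

    -- Edges `f` and `g` with a common end are not independent, so `g → e → f` would contradict
    -- transitivity.
    fromAt : ∀ {e f v} → O e f → Ends f v → FromAt e v
    fromAt {e} {f} ef fv {g} gv eg with total e g eg
    ... | inj₁ eg′ = eg′
    ... | inj₂ ge  = ⊥-elim (shared-end {g} {f} gv fv (⊆-indep g f (O-trans g e f ge ef)))

    mk-edge : ∀ {v w} → Adj G v w → ∃ λ f → Ends f v × Ends f w
    mk-edge {inj₁ x} {inj₂ y} xy = ((x , y) , xy) , inj₁ refl , inj₂ refl
    mk-edge {inj₂ y} {inj₁ x} xy = ((x , y) , xy) , inj₂ refl , inj₁ refl

    fromAt-adj : ∀ e {v w} → Adj G v w → Avoids e v → Avoids e w → FromAt e v → FromAt e w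
    fromAt-adj e {v} {w} vw av aw from with mk-edge {v} {w} vw
    ... | f , fv , fw = fromAt (from {f} fv (avoids⇒indep e f vw fv fw av aw)) fw

    -- An equivalence with the first vertex, because `transport` goes back to it from one edge and
    -- forth to the other, in whatever order the walk meets them.
    fromAt-walk : ∀ e {l} (w : Fin (suc l) → V G) → IsWalk G l w → (∀ j → Avoids e (w j)) →
      ∀ i → (FromAt e (w zero) → FromAt e (w i)) × (FromAt e (w i) → FromAt e (w zero))
    fromAt-walk e w walk av zero = id , id
    fromAt-walk e {suc l} w walk av (suc i) =
      let to , from = fromAt-walk e (w ∘ suc) (walk ∘ suc) (av ∘ suc) i in
      (λ q → to (fromAt-adj e {w zero} (walk zero) (av zero) (av (suc zero)) q)) ,
      (λ q → fromAt-adj e (adj-sym {w zero} {w (suc zero)} (walk zero)) (av (suc zero)) (av zero) (from q))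

    transport : ∀ {e f g l} (w : Fin (suc l) → V G) → IsWalk G l w → (∀ j → Avoids e (w j)) →
      Covers w f → Covers w g → O e f → O e g
    transport {e} {f} {g} w walk av ((i , wi) , _) g-covered@((j , wj) , _) ef =
      proj₁ (fromAt-walk e w walk av j) (proj₂ (fromAt-walk e w walk av i) (fromAt ef (inj₁ wi)))
        (inj₁ wj) (covers⇒indep e g av g-covered)

  -- The arc from e i to e (i + k), with either end moved in turn, travels around the asteroid
  -- and comes back reversed.
  module _ (k : ℕ) (ex : Fin (suc (k + k)) → Fin m) (ey : Fin (suc (k + k)) → Fin n)
    (asteroid : WeakEdgeAsteroidOn G k ex ey) where
    private
      edges = proj₁ asteroid
      walks = proj₂ asteroid
      N : ℕ
      N = suc (k + k)
      ι : ℕ → Fin N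
      ι j = fromℕ< (m%n<n j N)
      e : Fin N → EdgeOf G
      e i = (ex i , ey i) , edges i
      ê : ℕ → EdgeOf G
      ê = e ∘ ι

    ê-cong : ∀ {i j} → i % N ≡ j % N → ê i ≡ ê j
    ê-cong {i} {j} eq = cong e (fromℕ<-cong (i % N) (j % N) eq _ _)

    ê-⊕ : ∀ i j → e (_⊕_ G (ι i) j) ≡ ê (j + i)
    ê-⊕ i j = ê-cong {toℕ (ι i) + j} {j + i} (trans (cong (_% N) (trans (cong (_+ j) (toℕ-fromℕ< _)) (+-comm (i % N) j)))
      (+-%-cong j (k + k) (m%n%n≡m%n i N)))

    ê-period : ∀ j → ê (k + (suc k + j)) ≡ ê j
    ê-period j = ê-cong {k + (suc k + j)} {j} (trans (cong (_% N)
      (solve 2 (λ k j → k :+ (con 1 :+ k :+ j) := j :+ (con 1 :+ (k :+ k))) refl k j)) ([m+n]%n≡m%n j N))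
      where open +-*-Solver

    -- Moves the head of the arc; applied to `opposite-orientation C`, it moves the tail.
    shift : (C : IGComparability G) → ∀ j → proj₁ C (ê j) (ê (k + j)) → proj₁ C (ê j) (ê (suc k + j))
    shift C@(O , _) j o with walks (ι j)
    ... | l , w , walk , x , y , x′ , y′ , av =
      subst (O (ê j)) (ê-⊕ j (suc k))
        (transport C {ê j} {e (_⊕_ G (ι j) k)} {e (_⊕_ G (ι j) (suc k))}
          w walk av (x , y) (x′ , y′) (subst (O (ê j)) (sym (ê-⊕ j k)) o))

    no-start : (C : IGComparability G) → ¬ proj₁ C (ê 0) (ê (k + 0))
    no-start C@(O , _ , _ , asym , _) start =
      -- After `k + 1` rounds the arc runs from `ê (k + 1)` to `ê 0`, whereas moving the head of
      -- `start` once gives the reverse arc.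
      asym _ _ (shift C 0 start) (subst₂ O (cong ê (sym (+-identityʳ (suc k)))) back (travel (suc k)))
      where
      next : ∀ j → O (ê j) (ê (k + j)) → O (ê (suc j)) (ê (k + suc j))
      next j o = subst₂ O
        (trans (cong ê (sym (+-suc k (suc k + j))))
          (trans (cong (λ i → ê (k + suc i)) (sym (+-suc k j))) (ê-period (suc j))))
        (cong ê (sym (+-suc k j)))
        (shift (opposite-orientation C) (suc k + j)
          (subst (λ f → O f (ê (suc k + j))) (sym (ê-period j)) (shift C j o)))
      travel : ∀ j → O (ê j) (ê (k + j))
      travel zero    = start
      travel (suc j) = next j (travel j)
      back : ê (k + suc k) ≡ ê 0
      back = trans (cong (λ i → ê (k + i)) (sym (+-identityʳ (suc k)))) (ê-period 0)

    consecutive-indep : IndepEdges G (ê 0) (ê (k + 0))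
    consecutive-indep with walks (ι 0)
    ... | _ , _ , _ , x , y , _ , _ , av =
      subst (IndepEdges G (ê 0)) (ê-⊕ 0 k) (covers⇒indep (ê 0) (e (_⊕_ G (ι 0) k)) av (x , y))

  IG-comparability⇒¬weakEdgeAsteroid : IGComparability G → ¬ HasWeakEdgeAsteroid G
  IG-comparability⇒¬weakEdgeAsteroid C@(_ , _ , total , _) (k , _ , ex , ey , A) =
    [ no-start k ex ey A C , no-start k ex ey A (opposite-orientation C) ]′
      (total _ _ (consecutive-indep k ex ey A))

  -- Closed walks in the knotting graph of `I(G)` and edge-asteroids

  indep? : ∀ e f → Dec (IndepEdges G e f)
  indep? ((x , y) , _) ((x′ , y′) , _) =
    T? _ ×-dec T? _ ×-dec ¬? (x ≟ x′) ×-dec ¬? (y ≟ y′) ×-dec ¬? (T? _) ×-dec ¬? (T? _)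

  open Knotting (IndepEdges G) indep-sym (λ {e} (_ , _ , x≢x , _) → x≢x refl) indep?

  edge-≡ : ∀ {e f : EdgeOf G} → proj₁ e ≡ proj₁ f → e ≡ f
  edge-≡ {(x , y) , xy} {(x , y) , xy′} refl = cong ((x , y) ,_) (T-irrelevant xy xy′)

  Reach : EdgeOf G → V G → EdgeOf G → Set
  Reach e s g = ∃ λ l → Σ (Fin (suc l) → V G) λ w →
    IsWalk G l w × w zero ≡ s × Covers w g × (∀ j → Avoids e (w j))

  prepend : ∀ e {s g} t → Adj G t s → Avoids e t → Reach e s g → Reach e t g
  prepend e t ts at (l , w , walk , refl , ((i , wi) , (j , wj)) , av) =
    suc l , t ◂ w , (λ { zero → ts ; (suc i) → walk i }) , refl , ((suc i , wi) , (suc j , wj)) ,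
    λ { zero → at ; (suc i) → av i }

  avoidsˣ : ∀ {e x y xy} → IndepEdges G e ((x , y) , xy) → Avoids e (inj₁ x)
  avoidsˣ (_ , _ , _ , _ , _ , ¬x′y) = id , ¬x′y

  avoidsʸ : ∀ {e x y xy} → IndepEdges G e ((x , y) , xy) → Avoids e (inj₂ y)
  avoidsʸ (_ , _ , _ , _ , ¬xy′ , _) = ¬xy′ , id

  -- Consecutive edges of a link are not independent, so they share an end or an edge of `G` joins
  -- them; as both are independent of `e`, no end of theirs is adjacent to an end of `e`.
  link⇒reach : ∀ {e f g} → Link e f g → Reach e (inj₂ (proj₂ (proj₁ f))) g
  link⇒reach {e} {(x , y) , xy} (here ef) =
    1 , inj₂ y ◂ (inj₁ x ◂ λ ()) , (λ { zero → xy }) , refl , ((suc zero , refl) , (zero , refl)) ,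
    λ { zero → avoidsʸ {e} {xy = xy} ef ; (suc zero) → avoidsˣ {e} {xy = xy} ef }
  link⇒reach {e} {(x , y) , xy} {g} (step {b = (x′ , y′) , x′y′} ef ¬ff′ l) = join (link⇒reach l)
    where
    ef′ : IndepEdges G e ((x′ , y′) , x′y′)
    ef′ = link-left l
    ax  = avoidsˣ {e} {xy = xy} ef
    ay  = avoidsʸ {e} {xy = xy} ef
    ax′ = avoidsˣ {e} {xy = x′y′} ef′
    join : Reach e (inj₂ y′) g → Reach e (inj₂ y) g
    join r with x ≟ x′ | y ≟ y′ | T? (G x y′) | T? (G x′ y)
    ... | yes refl | _        | _        | _        = prepend e {inj₁ x} {g} (inj₂ y) xy ay (prepend e {g = g} (inj₁ x) x′y′ ax′ r)
    ... | no _     | yes refl | _        | _        = r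
    ... | no _     | no _     | yes xy′  | _        = prepend e {inj₁ x} {g} (inj₂ y) xy ay (prepend e {g = g} (inj₁ x) xy′ ax r)
    ... | no _     | no _     | no _     | yes x′y  = prepend e {inj₁ x′} {g} (inj₂ y) x′y ay (prepend e {g = g} (inj₁ x′) x′y′ ax′ r)
    ... | no x≢x′  | no y≢y′  | no ¬xy′  | no ¬x′y  =
      ⊥-elim (¬ff′ (xy , x′y′ , x≢x′ , y≢y′ , ¬xy′ , ¬x′y))

  link⇒walk : ∀ {e f g} → Link e f g → ∃ λ l → Σ (Fin (suc l) → V G) λ w →
    IsWalk G l w × Covers w f × Covers w g × (∀ j → Avoids e (w j))
  link⇒walk {e} {(x , y) , xy} link with link⇒reach link
  ... | l , w , walk , w₀ , ((i , wi) , (j , wj)) , av =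
    suc l , inj₁ x ◂ w ,
    (λ { zero → subst (Adj G (inj₁ x)) (sym w₀) xy ; (suc i) → walk i }) ,
    ((zero , refl) , (suc zero , w₀)) , ((suc i , wi) , (suc j , wj)) ,
    λ { zero → avoidsˣ {e} {xy = xy} (link-left link) ; (suc i) → av i }

  -- A closed walk g₀ g₁ … of length 2k + 1 has g (i - 1) linked to g (i + 1) at g i, so
  -- e i = g (2i) gives an edge-asteroid: 2(i + k) ≡ 2i - 1 and 2(i + k + 1) ≡ 2i + 1.
  closed-walk⇒asteroid : ∀ k {a b} (w : Walk (suc (k + k)) a b a b) → 1 ≤ k →
    (∀ {i j} → i < j → j < suc (k + k) → at w i ≢ at w j) → HasEdgeAsteroid G
  closed-walk⇒asteroid k {a} {b} w 1≤k distinct =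
    k , 1≤k , proj₁ ∘ proj₁ ∘ e , proj₂ ∘ proj₁ ∘ e , injective , proj₂ ∘ e , walks
    where
    N : ℕ
    N = suc (k + k)
    e : Fin N → EdgeOf G
    e i = at w ((2 * toℕ i) % N)

    injective-at : ∀ {i j} → i < N → j < N → at w i ≡ at w j → i ≡ j
    injective-at {i} {j} i<N j<N eq with <-cmp i j
    ... | tri< i<j _ _ = ⊥-elim (distinct i<j j<N eq)
    ... | tri≈ _ i≡j _ = i≡j
    ... | tri> _ _ j<i = ⊥-elim (distinct j<i i<N (sym eq))

    injective : ∀ i j → proj₁ (proj₁ (e i)) ≡ proj₁ (proj₁ (e j)) →
      proj₂ (proj₁ (e i)) ≡ proj₂ (proj₁ (e j)) → i ≡ j
    injective i j eqˣ eqʸ = toℕ-injective (double-%-injective k (toℕ<n i) (toℕ<n j)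
      (injective-at (m%n<n (2 * toℕ i) N) (m%n<n (2 * toℕ j) N) (edge-≡ (cong₂ _,_ eqˣ eqʸ))))

    -- The walk ends with its first edge, so positions `N` and `N + 1` repeat `0` and `1`; `1 ≤ k`
    -- ensures that `1 % N` is `1`.
    at-suc-% : ∀ {i} → i < N → at w (suc i) ≡ at w (suc i % N)
    at-suc-% {i} i<N with m≤n⇒m<n∨m≡n i<N
    ... | inj₁ i+1<N = cong (at w) (sym (m<n⇒m%n≡m i+1<N))
    ... | inj₂ refl  = trans (at-length w) (cong (at w) (sym (n%n≡0 N)))

    at-2+-% : ∀ {i} → i < N → at w (suc (suc i)) ≡ at w (suc (suc i) % N)
    at-2+-% {i} i<N with m≤n⇒m<n∨m≡n i<N
    ... | inj₁ i+1<N = at-suc-% i+1<N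
    ... | inj₂ refl  = trans (at-1+length w) (trans (sym (at-1 w)) (cong (at w)
            (trans (sym (m<n⇒m%n≡m (s≤s (≤-trans 1≤k (m≤m+n k k))))) (sym ([m+n]%n≡m%n 1 N)))))

    double-⊕ : ∀ i j → (2 * toℕ (_⊕_ G {k + k} i j)) % N ≡ (2 * (toℕ i + j)) % N
    double-⊕ i j = trans (cong (λ z → (2 * z) % N) (toℕ-fromℕ< (m%n<n (toℕ i + j) N))) (*-%ʳ 2 (toℕ i + j) (k + k))

    -- The position of `e (i ⊕ k)`, one step before that of `e i` modulo `N`.
    before : Fin N → ℕ
    before i = (2 * toℕ (_⊕_ G {k + k} i k)) % N

    before< : ∀ i → before i < N
    before< i = m%n<n (2 * toℕ (_⊕_ G {k + k} i k)) N

    shift-before : ∀ c i → (c + before i) % N ≡ (c + 2 * (toℕ i + k)) % N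
    shift-before c i = +-%-cong c (k + k)
      (trans (m%n%n≡m%n (2 * toℕ (_⊕_ G {k + k} i k)) N) (double-⊕ i k))

    at-before₁ : ∀ i → at w (suc (before i)) ≡ e i
    at-before₁ i = trans (at-suc-% (before< i)) (cong (at w) (trans (shift-before 1 i)
      (trans (cong (_% N) (solve 2 (λ i k → con 1 :+ con 2 :* (i :+ k) := con 2 :* i :+ (con 1 :+ (k :+ k))) refl (toℕ i) k))
        ([m+n]%n≡m%n (2 * toℕ i) N))))
      where open +-*-Solver

    at-before₂ : ∀ i → at w (suc (suc (before i))) ≡ e (_⊕_ G i (suc k))
    at-before₂ i = trans (at-2+-% (before< i)) (cong (at w) (trans (shift-before 2 i)
      (trans (cong (_% N) (solve 2 (λ i k → con 2 :+ con 2 :* (i :+ k) := con 2 :* (i :+ (con 1 :+ k))) refl (toℕ i) k))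
        (sym (double-⊕ i (suc k))))))
      where open +-*-Solver

    link : ∀ i → Link (e i) (e (_⊕_ G i k)) (e (_⊕_ G i (suc k)))
    link i = subst₂ (λ f g → Link f (e (_⊕_ G i k)) g) (at-before₁ i) (at-before₂ i) (at-link w (before< i))

    walks : ∀ i → _
    walks i with link⇒walk (link i)
    ... | l , v , walk , (x , y) , (x′ , y′) , av = l , v , walk , x , y , x′ , y′ , av

  no-odd-closed-walk : ¬ HasEdgeAsteroid G → ∀ {l} → Odd l → ∀ {a b} → ¬ Walk l a b a b
  no-odd-closed-walk ¬asteroid = no-odd-closed distinct⇒⊥ _
    where
    distinct⇒⊥ : ∀ {l a b} → Odd l → (w : Walk l a b a b) →
      (∀ {i j} → i < j → j < l → at w i ≢ at w j) → ⊥
    distinct⇒⊥ (suc even) w distinct with even⇒double even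
    ... | zero  , refl = walk₁-open w
    ... | suc k , refl = ¬asteroid (closed-walk⇒asteroid (suc k) w (s≤s z≤n) distinct)

  -- `xy` and `xw` share `x`, hence are linked at `x′y′`; likewise `x′y′` and `x′w′` at `xw`.
  fanˣ : ∀ {x x′ y y′ w w′ xy x′y′ xw x′w′} → Cross G x x′ y y′ → Cross G x x′ w w′ →
    Walk 2 ((x , y) , xy) ((x′ , y′) , x′y′) ((x , w) , xw) ((x′ , w′) , x′w′)
  fanˣ (cross xy x′y′ xy′ x′y) (cross xw x′w′ xw′ x′w) =
    step (cross⇒indep (cross x′y′ xy x′y xy′)) (λ (_ , _ , x≢x , _) → x≢x refl)
      (here (cross⇒indep (cross x′y′ xw x′w xy′))) ∷
    step (cross⇒indep (cross xw x′y′ xy′ x′w)) (λ (_ , _ , x≢x , _) → x≢x refl)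
      (here (cross⇒indep (cross xw x′w′ xw′ x′w))) ∷ []

  fanʸ : ∀ {x x′ y y′ z z′ xy x′y′ zy z′y′} → Cross G x x′ y y′ → Cross G z z′ y y′ →
    Walk 2 ((x , y) , xy) ((x′ , y′) , x′y′) ((z , y) , zy) ((z′ , y′) , z′y′)
  fanʸ (cross xy x′y′ xy′ x′y) (cross zy z′y′ zy′ z′y) =
    step (cross⇒indep (cross x′y′ xy x′y xy′)) (λ (_ , _ , _ , y≢y , _) → y≢y refl)
      (here (cross⇒indep (cross x′y′ zy x′y zy′))) ∷
    step (cross⇒indep (cross zy x′y′ zy′ x′y)) (λ (_ , _ , _ , y≢y , _) → y≢y refl)
      (here (cross⇒indep (cross zy z′y′ zy′ z′y))) ∷ []

  -- Each two-step changes first the ends in `Y`, then those in `X`, by one fan each; a last fan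
  -- reaches the prescribed edges. Fans have index two, so the total is even.
  twoSteps⇒walk : ∀ {x x′ y y′ xy x′y′ z z′ w w′ zw z′w′} →
    Cross G x x′ y y′ → Star (TwoStep G) (x , x′) (z , z′) → Cross G z z′ w w′ →
    ∃ λ l → Even l × Walk l ((x , y) , xy) ((x′ , y′) , x′y′) ((z , w) , zw) ((z′ , w′) , z′w′)
  twoSteps⇒walk k ε k′ = 2 , suc (suc zero) , fanˣ k k′
  twoSteps⇒walk k (_◅_ {j = _ , _} (_ , _ , k₁@(cross xy x′y′ _ _) , k₂@(cross zy z′y′ _ _)) ks) k′
    with twoSteps⇒walk {xy = ≡⇒E zy} {≡⇒E z′y′} k₂ ks k′
  ... | l , even , w = 4 + l , suc (suc (suc (suc even))) ,
    (fanˣ {xw = ≡⇒E xy} {≡⇒E x′y′} k k₁ ++ fanʸ k₁ k₂) ++ w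

  ¬edgeAsteroid⇒irreversible : ¬ HasEdgeAsteroid G → Irreversible
  ¬edgeAsteroid⇒irreversible ¬asteroid k@(cross uy vy′ _ _) ks
    with twoSteps⇒walk {xy = ≡⇒E uy} {≡⇒E vy′} k ks (cross-swap k)
  -- The walk exchanges the two edges; one more step closes it and makes the length odd.
  ... | l , even , w = no-odd-closed-walk ¬asteroid (suc even)
    (w ∷ʳ here (cross⇒indep k))

theorem3p7 : {m n : ℕ} (G : BiGraph m n) →
    (CocomparabilityBigraph G ⇔ Σ (Orientation G) (λ o → Acyclic G o × TFree G o)) ×
    (Σ (Orientation G) (λ o → Acyclic G o × TFree G o) ⇔ Σ (Orientation G) (λ o → TFree G o)) ×
    (Σ (Orientation G) (λ o → TFree G o) ⇔ (¬ HasInvertiblePair G)) ×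
    ((¬ HasInvertiblePair G) ⇔ (¬ HasWeakEdgeAsteroid G)) ×
    ((¬ HasWeakEdgeAsteroid G) ⇔ (¬ HasEdgeAsteroid G)) ×
    ((¬ HasEdgeAsteroid G) ⇔ IGComparability G)
-- Two cycles meet in (i): (i), (ii), (iii), (iv), (i) and (i), (vii), (v), (vi), (i).
theorem3p7 G =
  mk⇔ i⇒ii (iv⇒i ∘ iii⇒iv ∘ ii⇒iii) , mk⇔ ii⇒iii (i⇒ii ∘ iv⇒i ∘ iii⇒iv) ,
  mk⇔ iii⇒iv (ii⇒iii ∘ i⇒ii ∘ iv⇒i) , mk⇔ (vii⇒v ∘ i⇒vii ∘ iv⇒i) (iii⇒iv ∘ ii⇒iii ∘ i⇒ii ∘ vi⇒i ∘ v⇒vi) ,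
  mk⇔ v⇒vi (vii⇒v ∘ i⇒vii ∘ vi⇒i) , mk⇔ (i⇒vii ∘ vi⇒i) (v⇒vi ∘ vii⇒v)
  where
  i⇒ii = cocomparability⇒acyclic-T-free G
  i⇒vii = cocomparability⇒IG-comparability G
  iii⇒iv = T-free⇒¬invertible G
  vii⇒v = IG-comparability⇒¬weakEdgeAsteroid G
  ii⇒iii : Σ (Orientation G) (λ o → Acyclic G o × TFree G o) → Σ (Orientation G) (TFree G)
  ii⇒iii (o , _ , T-free) = o , T-free
  iv⇒i : ¬ HasInvertiblePair G → CocomparabilityBigraph G
  iv⇒i = irreversible⇒cocomparability G ∘ ¬invertible⇒irreversible G
  vi⇒i : ¬ HasEdgeAsteroid G → CocomparabilityBigraph G
  vi⇒i = irreversible⇒cocomparability G ∘ ¬edgeAsteroid⇒irreversible G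
  v⇒vi : ¬ HasWeakEdgeAsteroid G → ¬ HasEdgeAsteroid G
  v⇒vi ¬weak (k , 1≤k , ex , ey , _ , asteroid) = ¬weak (k , 1≤k , ex , ey , asteroid)
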